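{- Let $k_0\ge 1$ and $\epsilon>0$. Then there exists $n_0=n_0(k_0,\epsilon)$ such that, for all $n\ge n_0$ and $1\le k\le k_0$, the path graph $P_n$ satisfies \[ \sum_{i=1}^{2k}d_i(P_n)- \sum_{i=1}^k \lambda_i(L(P_n))<\epsilon. \]
   Context: $P_n$ is the path graph with $n$ vertices. For a finite simple graph $G$ on $n$ vertices, $d_i(G)$ ($1\le i\le n$) is the $i$-th largest vertex degree of $G$ (with multiplicity); thus $n_0\ge 2k_0$ is implicit, so that the sums make sense. $L(G)$ is the Laplacian matrix of $G$: $L(G)_{u,u}=\deg_G(u)$, $L(G)_{u,v}=-1$ if $\{u,v\}$ is an edge, and $0$ otherwise. For a symmetric real matrix $M$, $\lambda_i(M)$ is its $i$-th largest eigenvalue (with multiplicity). -}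

module Defs where

open import Algebra.Bundles.Raw using (RawRing)
import Algebra.Definitions.RawMonoid as RawMonoidOps
import Algebra.Definitions.RawSemiring as RawSemiringOps
open import Data.Fin.Base as Fin using (Fin; toℕ; inject≤)
import Data.Fin.Properties as Fin
import Data.Integer.Base as ℤ
open import Data.List.Base as List using (List)
import Data.List.Properties as List
open import Data.List.Relation.Binary.Permutation.Propositional.Properties
  using (↭-length)
import Data.List.Sort as Sort
open import Data.Nat.Base as ℕ using (ℕ; zero; suc)
import Data.Nat.Properties as ℕ
open import Data.Product.Base using (∃-syntax; _×_; _,_; proj₁; proj₂)
open import Data.Rational.Base as ℚ using (ℚ; 0ℚ; 1ℚ; ½)
import Data.Rational.Properties as ℚ
open import Data.Rational.Solver using (module +-*-Solver)
open import Data.Sum.Base using (_⊎_; inj₁; inj₂; swap)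
open import Data.Vec.Functional using (Vector; removeAt)
open import Function.Base using (_∘_)
open import Level using (0ℓ)
open import Relation.Binary.Core using (Rel)
open import Relation.Binary.Definitions using (Decidable; Irreflexive; Symmetric)
open import Relation.Binary.PropositionalEquality
import Relation.Binary.Construct.Flip.EqAndOrd as Flip
open import Relation.Nullary.Decidable using (yes; no; _⊎-dec_)

------------------------------------------------------------------------
-- Real numbers, as Cauchy sequences of rationals
------------------------------------------------------------------------

-- The existential is proof-relevant, so a real carries its modulus of
-- convergence; equality of reals is _≈_ below, not _≡_.
record ℝ : Set where
  constructor mkℝ
  field
    seq    : ℕ → ℚ
    cauchy : ∀ ε → 0ℚ ℚ.< ε →
             ∃[ N ] ∀ m n → N ℕ.≤ m → N ℕ.≤ n →
             ℚ.∣ seq m ℚ.- seq n ∣ ℚ.< ε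

open ℝ public

infix 4 _≈_ _<_ _≤_

_≈_ : Rel ℝ 0ℓ
x ≈ y = ∀ ε → 0ℚ ℚ.< ε →
        ∃[ N ] ∀ n → N ℕ.≤ n → ℚ.∣ seq x n ℚ.- seq y n ∣ ℚ.< ε

_<_ : Rel ℝ 0ℓ
x < y = ∃[ ε ] 0ℚ ℚ.< ε ×
        ∃[ N ] ∀ n → N ℕ.≤ n → seq x n ℚ.+ ε ℚ.≤ seq y n

_≤_ : Rel ℝ 0ℓ
x ≤ y = ∀ ε → 0ℚ ℚ.< ε →
        ∃[ N ] ∀ n → N ℕ.≤ n → seq x n ℚ.≤ seq y n ℚ.+ ε

fromℚ : ℚ → ℝ
fromℚ q .seq _ = q
fromℚ q .cauchy ε 0<ε = 0 , λ _ _ _ _ →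
  subst (ℚ._< ε) (sym (cong ℚ.∣_∣ (ℚ.+-inverseʳ q))) 0<ε

fromℕ : ℕ → ℝ
fromℕ n = fromℚ (ℤ.+ n ℚ./ 1)

0ℝ 1ℝ : ℝ
0ℝ = fromℚ 0ℚ
1ℝ = fromℚ 1ℚ

private
  half : ∀ {ε} → 0ℚ ℚ.< ε → 0ℚ ℚ.< ½ ℚ.* ε
  half {ε} 0<ε = subst (ℚ._< ½ ℚ.* ε) (ℚ.*-zeroʳ ½) (ℚ.*-monoʳ-<-pos ½ 0<ε)

  half+half : ∀ ε → ½ ℚ.* ε ℚ.+ ½ ℚ.* ε ≡ ε
  half+half ε = trans (sym (ℚ.*-distribʳ-+ ε ½ ½)) (ℚ.*-identityˡ ε)

  bounded : ∀ x → ∃[ B ] 0ℚ ℚ.< B ×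
            ∃[ N ] ∀ n → N ℕ.≤ n → ℚ.∣ seq x n ∣ ℚ.≤ B
  bounded x with cauchy x 1ℚ (ℚ.positive⁻¹ 1ℚ)
  ... | N , close = ℚ.∣ seq x N ∣ ℚ.+ 1ℚ
    , ℚ.+-mono-≤-< (ℚ.0≤∣p∣ (seq x N)) (ℚ.positive⁻¹ 1ℚ)
    , N , λ n N≤n → begin
        ℚ.∣ seq x n ∣
          ≡⟨ cong ℚ.∣_∣ (split (seq x n) (seq x N)) ⟩
        ℚ.∣ seq x N ℚ.+ (seq x n ℚ.- seq x N) ∣
          ≤⟨ ℚ.∣p+q∣≤∣p∣+∣q∣ (seq x N) _ ⟩
        ℚ.∣ seq x N ∣ ℚ.+ ℚ.∣ seq x n ℚ.- seq x N ∣
          ≤⟨ ℚ.+-monoʳ-≤ ℚ.∣ seq x N ∣ (ℚ.<⇒≤ (close n N N≤n ℕ.≤-refl)) ⟩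
        ℚ.∣ seq x N ∣ ℚ.+ 1ℚ ∎
    where
    open ℚ.≤-Reasoning
    open +-*-Solver
    split : ∀ p q → p ≡ q ℚ.+ (p ℚ.- q)
    split = solve 2 (λ p q → p := q :+ (p :- q)) refl

infixl 6 _+_ _-_
infixl 7 _*_
infix  8 -_

_+_ : ℝ → ℝ → ℝ
(x + y) .seq n = seq x n ℚ.+ seq y n
(x + y) .cauchy ε 0<ε
  with cauchy x (½ ℚ.* ε) (half 0<ε) | cauchy y (½ ℚ.* ε) (half 0<ε)
... | N₁ , close₁ | N₂ , close₂ = N₁ ℕ.⊔ N₂ , λ m n N≤m N≤n → begin-strict
  ℚ.∣ (seq x m ℚ.+ seq y m) ℚ.- (seq x n ℚ.+ seq y n) ∣
    ≡⟨ cong ℚ.∣_∣ (regroup (seq x m) (seq y m) (seq x n) (seq y n)) ⟩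
  ℚ.∣ (seq x m ℚ.- seq x n) ℚ.+ (seq y m ℚ.- seq y n) ∣
    ≤⟨ ℚ.∣p+q∣≤∣p∣+∣q∣ (seq x m ℚ.- seq x n) _ ⟩
  ℚ.∣ seq x m ℚ.- seq x n ∣ ℚ.+ ℚ.∣ seq y m ℚ.- seq y n ∣
    <⟨ ℚ.+-mono-<
         (close₁ m n (ℕ.m⊔n≤o⇒m≤o N₁ N₂ N≤m) (ℕ.m⊔n≤o⇒m≤o N₁ N₂ N≤n))
         (close₂ m n (ℕ.m⊔n≤o⇒n≤o N₁ N₂ N≤m) (ℕ.m⊔n≤o⇒n≤o N₁ N₂ N≤n)) ⟩
  ½ ℚ.* ε ℚ.+ ½ ℚ.* ε
    ≡⟨ half+half ε ⟩
  ε ∎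
  where
  open ℚ.≤-Reasoning
  open +-*-Solver
  regroup : ∀ a b c d →
    (a ℚ.+ b) ℚ.- (c ℚ.+ d) ≡ (a ℚ.- c) ℚ.+ (b ℚ.- d)
  regroup = solve 4
    (λ a b c d → (a :+ b) :- (c :+ d) := (a :- c) :+ (b :- d)) refl

-_ : ℝ → ℝ
(- x) .seq n = ℚ.- seq x n
(- x) .cauchy ε 0<ε with cauchy x ε 0<ε
... | N , close = N , λ m n N≤m N≤n →
  subst (ℚ._< ε)
    (trans (sym (ℚ.∣-p∣≡∣p∣ (seq x m ℚ.- seq x n)))
           (cong ℚ.∣_∣ (ℚ.neg-distrib-+ (seq x m) (ℚ.- seq x n))))
    (close m n N≤m N≤n)

_-_ : ℝ → ℝ → ℝ
x - y = x + (- y)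

private
  quotient : ∀ {K ε} → 0ℚ ℚ.< K → 0ℚ ℚ.< ε →
             ∃[ δ ] 0ℚ ℚ.< δ × K ℚ.* δ ≡ ε
  quotient {K} {ε} 0<K 0<ε = K⁻¹ ℚ.* ε
    , subst (ℚ._< K⁻¹ ℚ.* ε) (ℚ.*-zeroʳ K⁻¹)
        (ℚ.*-monoʳ-<-pos K⁻¹ {{ℚ.1/pos⇒pos K {{K-pos}}}} 0<ε)
    , trans (sym (ℚ.*-assoc K K⁻¹ ε))
        (trans (cong (ℚ._* ε) (ℚ.*-inverseʳ K {{K-nonZero}}))
               (ℚ.*-identityˡ ε))
    where
    K-pos : ℚ.Positive K
    K-pos = ℚ.positive 0<K
    K-nonZero : ℚ.NonZero K
    K-nonZero = ℚ.pos⇒nonZero K {{K-pos}}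
    K⁻¹ : ℚ
    K⁻¹ = (ℚ.1/ K) {{K-nonZero}}

  *-close : ∀ {A B δ} a b c d → 0ℚ ℚ.< A → 0ℚ ℚ.< B →
            ℚ.∣ a ∣ ℚ.≤ A → ℚ.∣ d ∣ ℚ.≤ B →
            ℚ.∣ a ℚ.- c ∣ ℚ.≤ δ → ℚ.∣ b ℚ.- d ∣ ℚ.≤ δ →
            ℚ.∣ a ℚ.* b ℚ.- c ℚ.* d ∣ ℚ.≤ (A ℚ.+ B) ℚ.* δ
  *-close {A} {B} {δ} a b c d 0<A 0<B a≤A d≤B ac≤δ bd≤δ = begin
    ℚ.∣ a ℚ.* b ℚ.- c ℚ.* d ∣
      ≡⟨ cong ℚ.∣_∣ (regroup a b c d) ⟩
    ℚ.∣ a ℚ.* (b ℚ.- d) ℚ.+ d ℚ.* (a ℚ.- c) ∣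
      ≤⟨ ℚ.∣p+q∣≤∣p∣+∣q∣ (a ℚ.* (b ℚ.- d)) (d ℚ.* (a ℚ.- c)) ⟩
    ℚ.∣ a ℚ.* (b ℚ.- d) ∣ ℚ.+ ℚ.∣ d ℚ.* (a ℚ.- c) ∣
      ≤⟨ ℚ.+-mono-≤ (term a (b ℚ.- d) 0<A a≤A bd≤δ)
                    (term d (a ℚ.- c) 0<B d≤B ac≤δ) ⟩
    A ℚ.* δ ℚ.+ B ℚ.* δ
      ≡⟨ ℚ.*-distribʳ-+ δ A B ⟨
    (A ℚ.+ B) ℚ.* δ ∎
    where
    open ℚ.≤-Reasoning
    open +-*-Solver
    term : ∀ {K} p q → 0ℚ ℚ.< K → ℚ.∣ p ∣ ℚ.≤ K → ℚ.∣ q ∣ ℚ.≤ δ →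
           ℚ.∣ p ℚ.* q ∣ ℚ.≤ K ℚ.* δ
    term {K} p q 0<K p≤K q≤δ = begin
      ℚ.∣ p ℚ.* q ∣
        ≡⟨ ℚ.∣p*q∣≡∣p∣*∣q∣ p q ⟩
      ℚ.∣ p ∣ ℚ.* ℚ.∣ q ∣
        ≤⟨ ℚ.*-monoʳ-≤-nonNeg ℚ.∣ q ∣ {{ℚ.∣-∣-nonNeg q}} p≤K ⟩
      K ℚ.* ℚ.∣ q ∣
        ≤⟨ ℚ.*-monoˡ-≤-nonNeg K {{ℚ.nonNegative (ℚ.<⇒≤ 0<K)}} q≤δ ⟩
      K ℚ.* δ ∎
    regroup : ∀ a b c d →
      a ℚ.* b ℚ.- c ℚ.* d ≡ a ℚ.* (b ℚ.- d) ℚ.+ d ℚ.* (a ℚ.- c)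
    regroup = solve 4
      (λ a b c d → a :* b :- c :* d := a :* (b :- d) :+ d :* (a :- c)) refl

  half<full : ∀ {ε} → 0ℚ ℚ.< ε → ½ ℚ.* ε ℚ.< ε
  half<full {ε} 0<ε = subst₂ ℚ._<_ (ℚ.+-identityʳ (½ ℚ.* ε)) (half+half ε)
                        (ℚ.+-monoʳ-< (½ ℚ.* ε) (half 0<ε))

  +-pos : ∀ {p q} → 0ℚ ℚ.< p → 0ℚ ℚ.< q → 0ℚ ℚ.< p ℚ.+ q
  +-pos {p} {q} 0<p 0<q = subst (ℚ._< p ℚ.+ q) (ℚ.+-identityʳ 0ℚ)
                            (ℚ.+-mono-< 0<p 0<q)

_*_ : ℝ → ℝ → ℝ
(x * y) .seq n = seq x n ℚ.* seq y n
(x * y) .cauchy ε 0<ε =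
  let A , 0<A , M₁ , ∣x∣≤A = bounded x
      B , 0<B , M₂ , ∣y∣≤B = bounded y
      δ , 0<δ , [A+B]δ≡ε/2 =
        quotient {A ℚ.+ B} {½ ℚ.* ε} (+-pos {A} {B} 0<A 0<B) (half {ε} 0<ε)
      N₁ , close₁ = cauchy x δ 0<δ
      N₂ , close₂ = cauchy y δ 0<δ
  in (M₁ ℕ.⊔ M₂) ℕ.⊔ (N₁ ℕ.⊔ N₂) , λ m n ≤m ≤n →
  let M≤m = ℕ.m⊔n≤o⇒m≤o (M₁ ℕ.⊔ M₂) (N₁ ℕ.⊔ N₂) ≤m
      M≤n = ℕ.m⊔n≤o⇒m≤o (M₁ ℕ.⊔ M₂) (N₁ ℕ.⊔ N₂) ≤n
      N≤m = ℕ.m⊔n≤o⇒n≤o (M₁ ℕ.⊔ M₂) (N₁ ℕ.⊔ N₂) ≤m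
      N≤n = ℕ.m⊔n≤o⇒n≤o (M₁ ℕ.⊔ M₂) (N₁ ℕ.⊔ N₂) ≤n
  in ℚ.≤-<-trans
       {ℚ.∣ seq x m ℚ.* seq y m ℚ.- seq x n ℚ.* seq y n ∣}
       {(A ℚ.+ B) ℚ.* δ} {ε}
       (*-close {A} {B} {δ} (seq x m) (seq y m) (seq x n) (seq y n) 0<A 0<B
         (∣x∣≤A m (ℕ.m⊔n≤o⇒m≤o M₁ M₂ M≤m))
         (∣y∣≤B n (ℕ.m⊔n≤o⇒n≤o M₁ M₂ M≤n))
         (ℚ.<⇒≤ (close₁ m n (ℕ.m⊔n≤o⇒m≤o N₁ N₂ N≤m) (ℕ.m⊔n≤o⇒m≤o N₁ N₂ N≤n)))
         (ℚ.<⇒≤ (close₂ m n (ℕ.m⊔n≤o⇒n≤o N₁ N₂ N≤m) (ℕ.m⊔n≤o⇒n≤o N₁ N₂ N≤n))))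
       (subst (ℚ._< ε) (sym [A+B]δ≡ε/2) (half<full {ε} 0<ε))

ℝ-rawRing : RawRing 0ℓ 0ℓ
ℝ-rawRing = record
  { Carrier = ℝ
  ; _≈_     = _≈_
  ; _+_     = _+_
  ; _*_     = _*_
  ; -_      = -_
  ; 0#      = 0ℝ
  ; 1#      = 1ℝ
  }

open RawSemiringOps (RawRing.rawSemiring ℝ-rawRing) public using (_^_)

∑ ∏ : ∀ {n} → Vector ℝ n → ℝ
∑ = RawMonoidOps.sum (RawRing.+-rawMonoid ℝ-rawRing)
∏ = RawMonoidOps.sum (RawRing.*-rawMonoid ℝ-rawRing)

------------------------------------------------------------------------
-- Eigenvalues
------------------------------------------------------------------------

Matrix : ℕ → Set
Matrix n = Fin n → Fin n → ℝ

minor : ∀ {n} → Matrix (suc n) → Fin (suc n) → Matrix n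
minor M j i = removeAt (M (Fin.suc i)) j

-- Laplace expansion along the first row.
det : ∀ {n} → Matrix n → ℝ
det {zero}  M = 1ℝ
det {suc n} M = ∑ λ j → (- 1ℝ) ^ toℕ j * (M Fin.zero j * det (minor M j))

scalar : ∀ {n} → ℝ → Matrix n
scalar x i j with i Fin.≟ j
... | yes _ = x
... | no  _ = 0ℝ

charpoly : ∀ {n} → Matrix n → ℝ → ℝ
charpoly M x = det λ i j → scalar x i j - M i j

-- The eigenvalues of M with multiplicity are the roots of det (xI - M) with
-- multiplicity.  λs at Fin index i is λᵢ₊₁(M); this is a relation because the
-- order on ℝ is undecidable, and its solution is unique up to _≈_.  Since ℝ is
-- infinite, polynomials are equal when their values are.
record IsSpectrum {n} (M : Matrix n) (λs : Vector ℝ n) : Set where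
  field
    decreasing : ∀ {i j} → i Fin.≤ j → λs j ≤ λs i
    factors    : ∀ x → charpoly M x ≈ ∏ λ i → x - λs i

------------------------------------------------------------------------
-- Graphs
------------------------------------------------------------------------

record SimpleGraph (n : ℕ) : Set₁ where
  field
    Adj    : Rel (Fin n) 0ℓ
    adj?   : Decidable Adj
    symm   : Symmetric Adj
    irrefl : Irreflexive _≡_ Adj

open SimpleGraph public

degree : ∀ {n} → SimpleGraph n → Fin n → ℕ
degree {n} G u = List.length (List.filter (adj? G u) (List.allFin n))

open Sort (Flip.decTotalOrder ℕ.≤-decTotalOrder) public
  using () renaming (sort to sort↓; sort-↭ to sort↓-↭; sort-↗ to sort↓-↘)

degreeList : ∀ {n} → SimpleGraph n → List ℕ
degreeList {n} G = List.map (degree G) (List.allFin n)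

degreeList-length : ∀ {n} (G : SimpleGraph n) →
                    List.length (sort↓ (degreeList G)) ≡ n
degreeList-length {n} G = trans (↭-length (sort↓-↭ (degreeList G)))
  (trans (List.length-map (degree G) (List.allFin n))
         (List.length-tabulate {n = n} (λ i → i)))

-- d G at Fin index i is dᵢ₊₁(G).
d : ∀ {n} → SimpleGraph n → Fin n → ℕ
d G i = List.lookup (sort↓ (degreeList G))
                    (Fin.cast (sym (degreeList-length G)) i)

laplacian : ∀ {n} → SimpleGraph n → Matrix n
laplacian G u v with u Fin.≟ v
... | yes _ = fromℕ (degree G u)
... | no  _ with adj? G u v
...   | yes _ = - 1ℝ
...   | no  _ = 0ℝ

path : ∀ n → SimpleGraph n
path n .Adj u v = suc (toℕ u) ≡ toℕ v ⊎ suc (toℕ v) ≡ toℕ u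
path n .adj? u v = (suc (toℕ u) ℕ.≟ toℕ v) ⊎-dec (suc (toℕ v) ℕ.≟ toℕ u)
path n .symm = swap
path n .irrefl refl (inj₁ eq) = ℕ.1+n≢n eq
path n .irrefl refl (inj₂ eq) = ℕ.1+n≢n eq

-- With m≤n : m ≤ n, ∑[ m≤n ] f is the sum of the first m entries of f.
∑[_]_ : ∀ {m n} → .(m ℕ.≤ n) → Vector ℝ n → ℝ
∑[ m≤n ] f = ∑ λ i → f (inject≤ i m≤n)

{-# OPTIONS --safe #-}

-- With x = 2 + 2 cos φ, the characteristic polynomial of L(Pₙ) at x satisfies
-- charpoly(x) sin φ = x sin(nφ).  Take φ = 2jθ for a rational rotation θ of
-- about 1/n such that cos 2nθ ≤ 0 < sin 2nθ.  Then Gⱼ = sin(2njθ) obeys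
-- Gⱼ₊₂ = 2 cos(2nθ) Gⱼ₊₁ - Gⱼ with a nonpositive middle coefficient, so it changes
-- sign at least every second step, and charpoly has k sign changes on the samples
-- j = 1, …, 2k+1, all of which are within O(k/n) of 4.  As ∏ (x - μᵢ) has the
-- sign (-1)^#{i | μᵢ > x}, k of the eigenvalues exceed the last sample.
-- The degrees are at most 2, so the difference of the two sums is small.
--
-- All of this happens in ℚ: charpoly at a rational point is a constant sequence,
-- and at a fixed late index of the Cauchy sequences the eigenvalues are rationals
-- whose order, and whose product ∏ (x - μᵢ) up to its sign, are right up to a
-- small δ.
module Submission where

open import Data.Bool.Base using (Bool; true; false; not; if_then_else_)
open import Data.Bool.Properties using (not-involutive)
open import Data.Empty using (⊥-elim)
open import Data.Fin.Base as Fin using (Fin; toℕ)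
import Data.Fin.Properties as Fin
open import Data.Integer.Base as ℤ using (+[1+_])
import Data.Integer.Properties as ℤ
import Data.List.Base as List
open import Data.List.Membership.Propositional.Properties using (∈-lookup)
open import Data.List.Relation.Binary.Permutation.Propositional using (↭-sym)
open import Data.List.Relation.Binary.Permutation.Propositional.Properties using (All-resp-↭)
import Data.List.Relation.Unary.All as All
import Data.List.Relation.Unary.All.Properties as All
open import Data.Nat.Base as ℕ using (ℕ; zero; suc)
import Data.Nat.Coprimality as Coprimality
import Data.Nat.Properties as ℕ
open import Data.Nat.Solver using () renaming (module +-*-Solver to ℕ-Solver)
open import Data.Product.Base using (Σ-syntax; ∃-syntax; _×_; _,_; proj₁; proj₂)
open import Data.Rational.Base as ℚ using (ℚ; 0ℚ; 1ℚ; ½)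
import Data.Rational.Properties as ℚ
open import Data.Rational.Solver using (module +-*-Solver)
open import Data.Sum.Base as Sum using (_⊎_; inj₁; inj₂; [_,_]′)
open import Data.Vec.Functional using (Vector; removeAt)
open import Function.Base using (_∘_)
open import Level using (0ℓ)
open import Relation.Binary.Definitions using (tri<; tri≈; tri>)
open import Relation.Binary.PropositionalEquality
  using (_≡_; _≢_; refl; sym; trans; cong; cong₂; subst; subst₂; module ≡-Reasoning)
open import Relation.Nullary using (¬_; does; yes; no)
open import Relation.Unary using (Pred; Decidable)
open import Algebra.Definitions.RawMonoid ℕ.+-0-rawMonoid using () renaming (sum to ℕsum)
open import Algebra.Definitions.RawMonoid ℚ.+-0-rawMonoid using () renaming (_×_ to _·_)
open import Algebra.Definitions.RawSemiring ℚ.+-*-rawSemiring using (sum; product)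
  renaming (_^_ to _^ℚ_)
open import Algebra.Properties.Monoid.Mult ℚ.+-0-monoid using ()
  renaming (×-homo-+ to ·-homo-+; ×-assocˡ to ·-assocˡ)
open import Algebra.Properties.Monoid.Sum ℚ.+-0-monoid using (sum-cong-≗; sum-replicate-zero)
open +-*-Solver using (solve; con; _:+_; _:*_; _:-_; :-_; _:=_)

-- Ordered-field arithmetic of ℚ and integer multiples.

module RationalLemmas where

  open import Data.Rational.Base
  open import Data.Rational.Properties

  0≤*0≤ : ∀ {p q} → 0ℚ ≤ p → 0ℚ ≤ q → 0ℚ ≤ p * q
  0≤*0≤ {p} {q} 0≤p 0≤q = nonNegative⁻¹ (p * q)
    {{nonNeg*nonNeg⇒nonNeg p {{nonNegative 0≤p}} q {{nonNegative 0≤q}}}}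

  0<*0< : ∀ {p q} → 0ℚ < p → 0ℚ < q → 0ℚ < p * q
  0<*0< {p} {q} 0<p 0<q = positive⁻¹ (p * q)
    {{pos*pos⇒pos p {{positive 0<p}} q {{positive 0<q}}}}

  0≤+0≤ : ∀ {p q} → 0ℚ ≤ p → 0ℚ ≤ q → 0ℚ ≤ p + q
  0≤+0≤ {p} {q} = +-mono-≤ {0ℚ} {p} {0ℚ} {q}

  0<+0≤ : ∀ {p q} → 0ℚ < p → 0ℚ ≤ q → 0ℚ < p + q
  0<+0≤ {p} {q} = +-mono-<-≤ {0ℚ} {p} {0ℚ} {q}

  p≤q⇒0≤q-p : ∀ {p q} → p ≤ q → 0ℚ ≤ q - p
  p≤q⇒0≤q-p {p} {q} p≤q = subst (_≤ q - p) (+-inverseʳ p) (+-monoˡ-≤ (- p) p≤q)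

  p<q⇒0<q-p : ∀ {p q} → p < q → 0ℚ < q - p
  p<q⇒0<q-p {p} {q} p<q = subst (_< q - p) (+-inverseʳ p) (+-monoˡ-< (- p) p<q)

  -- The form in which most inequalities below are proved: the ring solver checks an identity whose
  -- slack `r` is visibly a sum of products of nonnegative factors.
  p+r≡q⇒p≤q : ∀ {p q r} → p + r ≡ q → 0ℚ ≤ r → p ≤ q
  p+r≡q⇒p≤q {p} {r = r} refl 0≤r = subst (_≤ p + r) (+-identityʳ p) (+-monoʳ-≤ p 0≤r)

  p+r≡q⇒p<q : ∀ {p q r} → p + r ≡ q → 0ℚ < r → p < q
  p+r≡q⇒p<q {p} {r = r} refl 0<r = subst (_< p + r) (+-identityʳ p) (+-monoʳ-< p 0<r)

  ·-nonNeg : ∀ n {p} → 0ℚ ≤ p → 0ℚ ≤ n · p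
  ·-nonNeg zero    0≤p = ≤-refl
  ·-nonNeg (suc n) {p} 0≤p = 0≤+0≤ {p} {n · p} 0≤p (·-nonNeg n 0≤p)

  ·-monoˡ-≤ : ∀ {m n p} → 0ℚ ≤ p → m ℕ.≤ n → m · p ≤ n · p
  ·-monoˡ-≤ {n = n} 0≤p ℕ.z≤n = ·-nonNeg n 0≤p
  ·-monoˡ-≤ {p = p} 0≤p (ℕ.s≤s m≤n) = +-monoʳ-≤ p (·-monoˡ-≤ 0≤p m≤n)

  ·-monoʳ-≤ : ∀ n {p q} → p ≤ q → n · p ≤ n · q
  ·-monoʳ-≤ zero    p≤q = ≤-refl
  ·-monoʳ-≤ (suc n) p≤q = +-mono-≤ p≤q (·-monoʳ-≤ n p≤q)

  ·-cancelˡ-≤ : ∀ n {p q} → suc n · p ≤ suc n · q → p ≤ q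
  ·-cancelˡ-≤ n {p} {q} np≤nq = ≮⇒≥ λ q<p →
    <⇒≱ (+-mono-<-≤ q<p (·-monoʳ-≤ n (<⇒≤ q<p))) np≤nq
    where
    <⇒≱ : ∀ {p q} → p < q → ¬ (q ≤ p)
    <⇒≱ p<q q≤p = <-irrefl refl (<-≤-trans p<q q≤p)

  ·≡* : ∀ n p → n · p ≡ (n · 1ℚ) * p
  ·≡* zero    p = sym (*-zeroˡ p)
  ·≡* (suc n) p = trans (cong₂ _+_ (sym (*-identityˡ p)) (·≡* n p))
                        (sym (*-distribʳ-+ p 1ℚ (n · 1ℚ)))

  suc·1-pos : ∀ n → 0ℚ < suc n · 1ℚ
  suc·1-pos n = 0<+0≤ {1ℚ} {n · 1ℚ} (positive⁻¹ 1ℚ) (·-nonNeg n (nonNegative⁻¹ 1ℚ))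


  ·-÷ : ∀ n {q} → 0ℚ < q → ∃[ p ] 0ℚ < p × suc n · p ≡ q
  ·-÷ n {q} 0<q = K⁻¹ * q
    , 0<*0< {K⁻¹} {q} (positive⁻¹ K⁻¹ {{1/pos⇒pos K}}) 0<q
    , trans (·≡* (suc n) (K⁻¹ * q))
        (trans (sym (*-assoc K K⁻¹ q))
          (trans (cong (_* q) (*-inverseʳ K)) (*-identityˡ q)))
    where
    K = suc n · 1ℚ
    instance
      K-pos : Positive K
      K-pos = positive (suc·1-pos n)
      K-nonZero : NonZero K
      K-nonZero = pos⇒nonZero K
    K⁻¹ = 1/ K

  ·1≡mkℚ : ∀ n → n · 1ℚ ≡ mkℚ (ℤ.+ n) 0 (Coprimality.sym (Coprimality.1-coprimeTo n))
  ·1≡mkℚ zero    = refl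
  ·1≡mkℚ (suc n) = trans (cong (_+_ 1ℚ) (·1≡mkℚ n))
    (trans (cong (_/ 1) (cong (ℤ._+_ ℤ.1ℤ) (ℤ.*-identityʳ (ℤ.+ n))))
           (↥p/↧p≡p (mkℚ (ℤ.+ suc n) 0 (Coprimality.sym (Coprimality.1-coprimeTo (suc n))))))

  -- The denominator of `δ` is the multiplier: it turns `δ` into its numerator, a positive integer.
  archimedean : ∀ {δ} → 0ℚ < δ → ∃[ n ] 1ℚ ≤ suc n · δ
  archimedean {mkℚ +[1+ a ] d-1 cop} _ = d-1 , subst₂ _≤_
    (*-inverseˡ δ) (sym (·≡* (suc d-1) δ))
    (*-monoʳ-≤-nonNeg δ (subst (1/ δ ≤_) (sym (·1≡mkℚ (suc d-1)))
      (*≤* (ℤ.*-monoˡ-≤-nonNeg (ℤ.+ suc d-1) (ℤ.+≤+ (ℕ.s≤s ℕ.z≤n))))))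
    where δ = mkℚ +[1+ a ] d-1 cop
  archimedean {mkℚ (ℤ.+ 0) _ _} (*<* (ℤ.+<+ ()))
  archimedean {mkℚ (ℤ.-[1+ _ ]) _ _} (*<* ())

  -- Trigonometry of the multiples of a rational rotation.

  module Rotation (c s : ℚ) where

    -- Real and imaginary part of the m-th power of `c + i s`. For a point of the unit circle at
    -- angle θ these are the cosine and sine of mθ, so no real trigonometry enters.
    cos sin : ℕ → ℚ
    cos zero    = 1ℚ
    cos (suc m) = c * cos m - s * sin m
    sin zero    = 0ℚ
    sin (suc m) = s * cos m + c * sin m

    cos-+ : ∀ m l → cos (m ℕ.+ l) ≡ cos m * cos l - sin m * sin l
    sin-+ : ∀ m l → sin (m ℕ.+ l) ≡ sin m * cos l + cos m * sin l
    cos-+ zero    l = solve 2 (λ C S → C := con 1ℚ :* C :- con 0ℚ :* S) refl (cos l) (sin l)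
    cos-+ (suc m) l rewrite cos-+ m l | sin-+ m l =
      solve 6 (λ c s C S C′ S′ → c :* (C :* C′ :- S :* S′) :- s :* (S :* C′ :+ C :* S′)
        := (c :* C :- s :* S) :* C′ :- (s :* C :+ c :* S) :* S′)
        refl c s (cos m) (sin m) (cos l) (sin l)
    sin-+ zero    l = solve 2 (λ C S → S := con 0ℚ :* C :+ con 1ℚ :* S) refl (cos l) (sin l)
    sin-+ (suc m) l rewrite cos-+ m l | sin-+ m l =
      solve 6 (λ c s C S C′ S′ → s :* (C :* C′ :- S :* S′) :+ c :* (S :* C′ :+ C :* S′)
        := (s :* C :+ c :* S) :* C′ :+ (c :* C :- s :* S) :* S′)
        refl c s (cos m) (sin m) (cos l) (sin l)

    module _ (c²+s²≡1 : c * c + s * s ≡ 1ℚ) where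

      cos²+sin²≡1 : ∀ m → cos m * cos m + sin m * sin m ≡ 1ℚ
      cos²+sin²≡1 zero    = refl
      cos²+sin²≡1 (suc m) = trans
        (solve 4 (λ c s C S → (c :* C :- s :* S) :* (c :* C :- s :* S)
                           :+ (s :* C :+ c :* S) :* (s :* C :+ c :* S)
           := (c :* c :+ s :* s) :* (C :* C :+ S :* S)) refl c s (cos m) (sin m))
        (cong₂ _*_ c²+s²≡1 (cos²+sin²≡1 m))

      -- Drives both recurrences used later: the Chebyshev one behind `continuant-sin`, and `G-rec`
      -- from one sample to the next.
      sin-three-term : ∀ l q →
        sin (l ℕ.+ (l ℕ.+ q)) ≡ (cos l + cos l) * sin (l ℕ.+ q) - sin q
      sin-three-term l q rewrite sin-+ l (l ℕ.+ q) | cos-+ l q | sin-+ l q = trans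
        (solve 4 (λ C S C′ S′ →
           S :* (C :* C′ :- S :* S′) :+ C :* (S :* C′ :+ C :* S′)
           := (C :+ C) :* (S :* C′ :+ C :* S′) :- (C :* C :+ S :* S) :* S′)
           refl (cos l) (sin l) (cos q) (sin q))
        (cong (λ z → (cos l + cos l) * (sin l * cos q + cos l * sin q) - z)
          (trans (cong (_* sin q) (cos²+sin²≡1 l)) (*-identityˡ (sin q))))

    -- Here `b + b` stands in for an upper bound of the angle θ: the hypotheses give sin θ ≤ 2b and
    -- cos θ ≥ 1 - (2b)²/2. By `nb≡½` the n-fold bound is 1, and `c≤ns` says n tan θ ≥ 1.
    module Estimates
      {b n} (0≤b : 0ℚ ≤ b) (0<s : 0ℚ < s) (s≤2b : s ≤ b + b)
      (0<c : 0ℚ < c) (c≤1 : c ≤ 1ℚ) (1≤c+2b² : 1ℚ ≤ c + (b * b + b * b))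
      (nb≡½ : n · b ≡ ½) (c≤ns : c ≤ n · s) where

      private
        0≤s = <⇒≤ 0<s
        0≤c = <⇒≤ 0<c
        0≤1-c = p≤q⇒0≤q-p c≤1

      ·b≤½ : ∀ {m} → m ℕ.≤ n → m · b ≤ ½
      ·b≤½ {m} m≤n = subst (m · b ≤_) nb≡½ (·-monoˡ-≤ 0≤b m≤n)

      -- With x = 2mb, the estimates 0 ≤ sin ≤ x and 1 - x²/2 ≤ cos ≤ 1. They are bundled because
      -- their induction steps use one another; `½≤cos` keeps the cosine positive for the next step.
      record Small (m : ℕ) : Set where
        field
          0≤sin : 0ℚ ≤ sin m
          sin≤  : sin m ≤ m · b + m · b
          cos≤1 : cos m ≤ 1ℚ
          1≤cos : 1ℚ ≤ cos m + (m · b * m · b + m · b * m · b)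
          ½≤cos : ½ ≤ cos m

      open Small

      private
        0≤cos′ : ∀ {m} → ½ ≤ cos m → 0ℚ ≤ cos m
        0≤cos′ = ≤-trans (nonNegative⁻¹ ½)

        cos-step : ∀ m → ½ ≤ cos m → 0ℚ ≤ sin m → cos (suc m) ≤ cos m
        cos-step m ½≤C 0≤S = p+r≡q⇒p≤q
          (solve 4 (λ c s C S → c :* C :- s :* S :+ ((con 1ℚ :- c) :* C :+ s :* S) := C)
            refl c s (cos m) (sin m))
          (0≤+0≤ {(1ℚ - c) * cos m} {s * sin m}
            (0≤*0≤ {1ℚ - c} {cos m} 0≤1-c (0≤cos′ {m} ½≤C))
            (0≤*0≤ {s} {sin m} 0≤s 0≤S))

      small : ∀ m → m ℕ.≤ n → Small m
      small zero _ = record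
        { 0≤sin = ≤-refl ; sin≤ = ≤-refl ; cos≤1 = ≤-refl ; 1≤cos = ≤-refl
        ; ½≤cos = ≤ᵇ⇒≤ _ }
      small (suc m) m<n = record
        { 0≤sin = 0≤+0≤ {s * C} {c * S} (0≤*0≤ {s} {C} 0≤s 0≤C) (0≤*0≤ {c} {S} 0≤c (0≤sin ih))
        ; sin≤  = p+r≡q⇒p≤q
            (solve 6 (λ c s C S b t → s :* C :+ c :* S
                :+ (((b :+ b) :- s :+ s :* (con 1ℚ :- C)) :+ ((t :+ t) :- S :+ (con 1ℚ :- c) :* S))
                := (b :+ t) :+ (b :+ t)) refl c s C S b t)
            (0≤+0≤ {b + b - s + s * (1ℚ - C)} {t + t - S + (1ℚ - c) * S}
              (0≤+0≤ {b + b - s} {s * (1ℚ - C)} 0≤2b-s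
                (0≤*0≤ {s} {1ℚ - C} 0≤s 0≤1-C))
              (0≤+0≤ {t + t - S} {(1ℚ - c) * S} 0≤2t-S
                (0≤*0≤ {1ℚ - c} {S} 0≤1-c (0≤sin ih))))
        ; cos≤1 = ≤-trans (cos-step m (½≤cos ih) (0≤sin ih)) (cos≤1 ih)
        ; 1≤cos = 1≤cos′
        ; ½≤cos = ½≤cos″
        }
        where
        ih = small m (ℕ.<⇒≤ m<n)
        C = cos m
        S = sin m
        t = m · b
        0≤C = 0≤cos′ {m} (½≤cos ih)
        0≤t = ·-nonNeg m 0≤b
        0≤2b-s = p≤q⇒0≤q-p s≤2b
        0≤2t-S = p≤q⇒0≤q-p (sin≤ ih)
        0≤1-C = p≤q⇒0≤q-p (cos≤1 ih)
        t′ = b + t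
        1≤cos′ : 1ℚ ≤ cos (suc m) + (t′ * t′ + t′ * t′)
        -- Of `2 (b + t)² = 2 b² + 2 t² + 4 b t`, the squares pay for the losses in `c` and `C`, and
        -- the cross term for `s * S`, which is at most `2 b` times `2 t`.
        1≤cos′ = p+r≡q⇒p≤q
          (solve 6 (λ c s C S b t → con 1ℚ
             :+ (((c :+ (b :* b :+ b :* b)) :- con 1ℚ) :* C
                 :+ ((C :+ (t :* t :+ t :* t)) :- con 1ℚ)
                 :+ ((b :* b :+ b :* b) :* (con 1ℚ :- C)
                 :+ ((b :+ b :- s) :* (t :+ t) :+ s :* (t :+ t :- S))))
             := c :* C :- s :* S :+ ((b :+ t) :* (b :+ t) :+ (b :+ t) :* (b :+ t)))
             refl c s C S b t)
          (0≤+0≤ {(c + (b * b + b * b) - 1ℚ) * C + (C + (t * t + t * t) - 1ℚ)}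
                 {(b * b + b * b) * (1ℚ - C) + ((b + b - s) * (t + t) + s * (t + t - S))}
            (0≤+0≤ {(c + (b * b + b * b) - 1ℚ) * C} {C + (t * t + t * t) - 1ℚ}
              (0≤*0≤ {c + (b * b + b * b) - 1ℚ} {C} (p≤q⇒0≤q-p 1≤c+2b²) 0≤C)
              (p≤q⇒0≤q-p (1≤cos ih)))
            (0≤+0≤ {(b * b + b * b) * (1ℚ - C)} {(b + b - s) * (t + t) + s * (t + t - S)}
              (0≤*0≤ {b * b + b * b} {1ℚ - C}
                (0≤+0≤ {b * b} {b * b} (0≤*0≤ {b} {b} 0≤b 0≤b) (0≤*0≤ {b} {b} 0≤b 0≤b)) 0≤1-C)
              (0≤+0≤ {(b + b - s) * (t + t)} {s * (t + t - S)}
                (0≤*0≤ {b + b - s} {t + t} 0≤2b-s (0≤+0≤ {t} {t} 0≤t 0≤t))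
                (0≤*0≤ {s} {t + t - S} 0≤s 0≤2t-S))))
        ½≤cos″ : ½ ≤ cos (suc m)
        -- The remaining slack `½ - 2 t′²` factors as `2 (½ - t′) (t′ + ½)`, and `t′ ≤ ½`.
        ½≤cos″ = p+r≡q⇒p≤q
          (solve 2 (λ C t → con ½ :+ (((C :+ (t :* t :+ t :* t)) :- con 1ℚ)
               :+ ((con ½ :- t) :* (t :+ con ½) :+ (con ½ :- t) :* (t :+ con ½))) := C)
            refl (cos (suc m)) t′)
          (0≤+0≤ {cos (suc m) + (t′ * t′ + t′ * t′) - 1ℚ} {(½ - t′) * (t′ + ½) + (½ - t′) * (t′ + ½)}
            (p≤q⇒0≤q-p 1≤cos′)
            (0≤+0≤ {(½ - t′) * (t′ + ½)} {(½ - t′) * (t′ + ½)} 0≤prod 0≤prod))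
          where
          0≤prod = 0≤*0≤ {½ - t′} {t′ + ½} (p≤q⇒0≤q-p (·b≤½ m<n))
                     (0≤+0≤ {t′} {½} (0≤+0≤ {b} {t} 0≤b 0≤t) (nonNegative⁻¹ ½))

      0<cos : ∀ {m} → m ℕ.≤ n → 0ℚ < cos m
      0<cos {m} m≤n = <-≤-trans (positive⁻¹ ½) (½≤cos (small m m≤n))

      0<sin : ∀ {m} → suc m ℕ.≤ n → 0ℚ < sin (suc m)
      0<sin {m} m<n = 0<+0≤ {s * cos m} {c * sin m} (0<*0< {s} {cos m} 0<s (0<cos m≤n))
        (0≤*0≤ {c} {sin m} 0≤c (0≤sin (small m m≤n)))
        where m≤n = ℕ.<⇒≤ m<n

      cos-anti : ∀ {l m} → l ℕ.≤′ m → m ℕ.≤ n → cos m ≤ cos l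
      cos-anti ℕ.≤′-refl _ = ≤-refl
      cos-anti (ℕ.≤′-step {m} l≤m) m<n = ≤-trans (cos-step m (½≤cos sm) (0≤sin sm))
                                                 (cos-anti l≤m (ℕ.<⇒≤ m<n))
        where sm = small m (ℕ.<⇒≤ m<n)

      -- For `t = m · b ≤ ½` the quadratic loss `2 t²` is at most `t`. A linear bound suffices to
      -- keep the samples within O(k/n) of 4.
      1≤cos+2mb : ∀ {m} → m ℕ.≤ n → 1ℚ ≤ cos m + m · b
      1≤cos+2mb {m} m≤n = ≤-trans (1≤cos (small m m≤n)) (+-monoʳ-≤ (cos m) (p+r≡q⇒p≤q
        (solve 1 (λ t → t :* t :+ t :* t :+ ((con ½ :- t) :* t :+ (con ½ :- t) :* t) := t)
          refl t)
        (0≤+0≤ {(½ - t) * t} {(½ - t) * t} 0≤prod 0≤prod)))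
        where
        t = m · b
        0≤prod = 0≤*0≤ {½ - t} {t} (p≤q⇒0≤q-p (·b≤½ m≤n)) (·-nonNeg m 0≤b)

      -- tan (mθ) ≥ m tan θ, cleared of denominators.
      tan-superadditive : ∀ m → m ℕ.≤ n → m · s * cos m ≤ c * sin m
      tan-superadditive zero    _   = ≤-reflexive (trans (*-zeroˡ 1ℚ) (sym (*-zeroʳ c)))
      tan-superadditive (suc m) m<n = p+r≡q⇒p≤q
        (solve 5 (λ c s C S t → (s :+ t) :* (c :* C :- s :* S)
             :+ (c :* (c :* S :- t :* C) :+ (s :+ t) :* (s :* S))
           := c :* (s :* C :+ c :* S)) refl c s (cos m) (sin m) (m · s))
        (0≤+0≤ {c * (c * sin m - m · s * cos m)} {(s + m · s) * (s * sin m)}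
          (0≤*0≤ {c} {c * sin m - m · s * cos m} 0≤c
            (p≤q⇒0≤q-p (tan-superadditive m m≤n)))
          (0≤*0≤ {s + m · s} {s * sin m} (0≤+0≤ {s} {m · s} 0≤s (·-nonNeg m 0≤s))
            (0≤*0≤ {s} {sin m} 0≤s (0≤sin (small m m≤n)))))
        where m≤n = ℕ.<⇒≤ m<n

      -- tan nθ ≥ n tan θ ≥ 1, so nθ has reached π/4 and its double a quarter turn.
      cos≤sin : cos n ≤ sin n
      cos≤sin = *-cancelˡ-≤-pos c {{positive 0<c}} (≤-trans
        (*-monoʳ-≤-nonNeg (cos n) {{nonNegative (<⇒≤ (0<cos ℕ.≤-refl))}} c≤ns)
        (tan-superadditive n ℕ.≤-refl))

      cos[2n]≤0 : cos (n ℕ.+ n) ≤ 0ℚ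
      cos[2n]≤0 = subst (_≤ 0ℚ) (sym (cos-+ n n)) (p+r≡q⇒p≤q
        (solve 2 (λ C S → C :* C :- S :* S :+ (S :- C) :* (S :+ C) := con 0ℚ)
          refl (cos n) (sin n))
        (0≤*0≤ {sin n - cos n} {sin n + cos n} (p≤q⇒0≤q-p cos≤sin)
          (0≤+0≤ {sin n} {cos n} (0≤sin (small n ℕ.≤-refl)) (<⇒≤ (0<cos ℕ.≤-refl)))))

      0<sin[2n] : 0ℚ < sin (n ℕ.+ n)
      0<sin[2n] = subst (0ℚ <_) (sym (sin-+ n n))
        (0<+0≤ {sin n * cos n} {cos n * sin n} 0<SC (0≤*0≤ {cos n} {sin n} 0≤C 0≤S))
        where
        0≤C = <⇒≤ (0<cos ℕ.≤-refl)
        0≤S = 0≤sin (small n ℕ.≤-refl)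
        0<SC = 0<*0< {sin n} {cos n}
          (<-≤-trans (0<cos ℕ.≤-refl) cos≤sin) (0<cos ℕ.≤-refl)

  -- Signs, and the number of entries above a point.

  *-positive⁻ : ∀ {p q} → 0ℚ < p → 0ℚ < p * q → 0ℚ < q
  *-positive⁻ {p} {q} 0<p 0<pq = *-cancelˡ-<-nonNeg p {{nonNegative (<⇒≤ 0<p)}}
    (subst (_< p * q) (sym (*-zeroʳ p)) 0<pq)

  *-negative⁻ : ∀ {p q} → 0ℚ < p → p * q < 0ℚ → q < 0ℚ
  *-negative⁻ {p} {q} 0<p pq<0 = *-cancelˡ-<-nonNeg p {{nonNegative (<⇒≤ 0<p)}}
    (subst (p * q <_) (sym (*-zeroʳ p)) pq<0)

  odd : ℕ → Bool
  odd zero    = false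
  odd (suc n) = not (odd n)

  -- `true` stands for negative, so that the index of a product is the parity of its negative
  -- factors. Zero has no sign.
  data Sign (p : ℚ) : Bool → Set where
    isPos : 0ℚ < p → Sign p false
    isNeg : p < 0ℚ → Sign p true

  negate : ∀ {p b} → Sign p b → Sign (- p) (not b)
  negate (isPos 0<p) = isNeg (neg-antimono-< 0<p)
  negate (isNeg p<0) = isPos (neg-antimono-< p<0)

  Sign-*⁻ : ∀ {p q b} → 0ℚ < p → Sign (p * q) b → Sign q b
  Sign-*⁻ {p} {q} 0<p (isPos 0<pq) = isPos (*-positive⁻ {p} {q} 0<p 0<pq)
  Sign-*⁻ {p} {q} 0<p (isNeg pq<0) = isNeg (*-negative⁻ {p} {q} 0<p pq<0)

  Sign-* : ∀ {p q b} → 0ℚ < p → Sign q b → Sign (p * q) b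
  Sign-* {p} {q} 0<p (isPos 0<q) = isPos (0<*0< {p} {q} 0<p 0<q)
  Sign-* {p} {q} 0<p (isNeg q<0) = isNeg (subst (p * q <_) (*-zeroʳ p)
    (*-monoʳ-<-pos p {{positive 0<p}} q<0))

  Sign-0 : ∀ {b} → ¬ Sign 0ℚ b
  Sign-0 (isPos 0<0) = <-irrefl refl 0<0
  Sign-0 (isNeg 0<0) = <-irrefl refl 0<0

  #above : ∀ {n} → ℚ → Vector ℚ n → ℕ
  #above {zero}  x μ = 0
  #above {suc n} x μ with x <? μ Fin.zero
  ... | yes _ = suc (#above x (μ ∘ Fin.suc))
  ... | no  _ = #above x (μ ∘ Fin.suc)

  -- The factor `x - μ i` is negative exactly for the counted entries, and none can vanish because
  -- the product has a sign.
  #above-parity : ∀ {n b} x (μ : Vector ℚ n) →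
                  Sign (product λ i → x - μ i) b → odd (#above x μ) ≡ b
  #above-parity {zero} x μ (isPos _)   = refl
  #above-parity {zero} x μ (isNeg 1<0) = ⊥-elim (<-asym 1<0 (positive⁻¹ 1ℚ))
  #above-parity {suc n} {b} x μ sgn with x <? μ Fin.zero
  ... | yes x<μ = trans (cong not (#above-parity x (μ ∘ Fin.suc) (Sign-*⁻
          (p<q⇒0<q-p x<μ)
          (subst (λ p → Sign p (not b)) eq (negate sgn)))))
          (not-involutive b)
    where
    eq = solve 3 (λ x m F → :- ((x :- m) :* F) := (m :- x) :* F) refl
           x (μ Fin.zero) (product λ i → x - μ (Fin.suc i))
  ... | no x≮μ with <-cmp (μ Fin.zero) x
  ...   | tri< μ<x _ _ = #above-parity x (μ ∘ Fin.suc) (Sign-*⁻ (p<q⇒0<q-p μ<x) sgn)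
  ...   | tri> _ _ x<μ = ⊥-elim (x≮μ x<μ)
  ...   | tri≈ _ refl _ = ⊥-elim (Sign-0 (subst (λ p → Sign p b)
            (trans (cong (_* F) (+-inverseʳ x)) (*-zeroˡ F)) sgn))
    where F = product λ i → x - μ (Fin.suc i)

  #above-anti : ∀ {n x y} (μ : Vector ℚ n) → x ≤ y → #above y μ ℕ.≤ #above x μ
  #above-anti {zero} μ x≤y = ℕ.z≤n
  #above-anti {suc n} {x} {y} μ x≤y with y <? μ Fin.zero | x <? μ Fin.zero
  ... | yes _   | yes _   = ℕ.s≤s (#above-anti (μ ∘ Fin.suc) x≤y)
  ... | yes y<μ | no  x≮μ = ⊥-elim (x≮μ (≤-<-trans x≤y y<μ))
  ... | no  _   | yes _   = ℕ.m≤n⇒m≤1+n (#above-anti (μ ∘ Fin.suc) x≤y)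
  ... | no  _   | no  _   = #above-anti (μ ∘ Fin.suc) x≤y

  #above-≤ : ∀ {n} x (μ : Vector ℚ n) m → (∀ j → m ℕ.≤ toℕ j → μ j ≤ x) →
             #above x μ ℕ.≤ m
  #above-≤ {zero} x μ m h = ℕ.z≤n
  #above-≤ {suc n} x μ m h with x <? μ Fin.zero
  #above-≤ {suc n} x μ zero h | yes x<μ =
    ⊥-elim (<-irrefl refl (<-≤-trans x<μ (h Fin.zero ℕ.z≤n)))
  #above-≤ {suc n} x μ (suc m) h | yes x<μ =
    ℕ.s≤s (#above-≤ x (μ ∘ Fin.suc) m (λ j m≤j → h (Fin.suc j) (ℕ.s≤s m≤j)))
  #above-≤ {suc n} x μ zero h | no _ =
    #above-≤ x (μ ∘ Fin.suc) zero (λ j _ → h (Fin.suc j) ℕ.z≤n)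
  #above-≤ {suc n} x μ (suc m) h | no _ =
    ℕ.m≤n⇒m≤1+n (#above-≤ x (μ ∘ Fin.suc) m (λ j m≤j → h (Fin.suc j) (ℕ.s≤s m≤j)))

  -- A three-term recurrence with nonpositive middle coefficient changes sign at
  -- least every two steps.
  module Oscillation (G : ℕ → ℚ) {κ} (κ≤0 : κ ≤ 0ℚ)
    (rec : ∀ j → G (suc (suc j)) ≡ κ * G (suc j) - G j) where

    private
      kernel : ∀ {p q r} → r ≡ κ * q - p → 0ℚ < p → 0ℚ ≤ q → r < 0ℚ
      kernel {p} {q} refl 0<p 0≤q = p+r≡q⇒p<q
        (solve 3 (λ k p q → k :* q :- p :+ (p :+ (con 0ℚ :- k) :* q) := con 0ℚ) refl κ p q)
        (0<+0≤ {p} {(0ℚ - κ) * q} 0<p (0≤*0≤ {0ℚ - κ} {q} (p≤q⇒0≤q-p κ≤0) 0≤q))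

      neg-rec : ∀ {p q r} → r ≡ κ * q - p → - r ≡ κ * (- q) - (- p)
      neg-rec {p} {q} refl =
        solve 3 (λ k p q → :- (k :* q :- p) := k :* (:- q) :- (:- p)) refl κ p q

      unneg : ∀ {p} → - p < 0ℚ → 0ℚ < p
      unneg {p} -p<0 = subst (0ℚ <_) (solve 1 (λ p → :- (:- p) := p) refl p)
                         (neg-antimono-< -p<0)

    -- If the next value does not switch sign, possibly being zero, then in the value after it both
    -- `κ * G (suc j)` and `- G j` point away from the sign of `G j`, the second one strictly.
    sign-change : ∀ {j b} → Sign (G j) b →
                  Sign (G (suc j)) (not b) ⊎ Sign (G (suc (suc j))) (not b)
    sign-change {j} (isPos 0<G) with G (suc j) <? 0ℚ
    ... | yes G′<0 = inj₁ (isNeg G′<0)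
    ... | no  G′≮0 = inj₂ (isNeg (kernel (rec j) 0<G (≮⇒≥ G′≮0)))
    sign-change {j} (isNeg G<0) with 0ℚ <? G (suc j)
    ... | yes 0<G′ = inj₁ (isPos 0<G′)
    ... | no  0≮G′ = inj₂ (isPos (unneg (kernel (neg-rec (rec j))
                       (neg-antimono-< G<0) (neg-antimono-≤ (≮⇒≥ 0≮G′)))))

    -- To be applied with `N j` the number of eigenvalues above the j-th sample. A sign change of
    -- `G` flips the parity of this monotone count and so raises it by at least one.
    module _ (0<G1 : 0ℚ < G 1) {J} (N : ℕ → ℕ)
      (mono : ∀ {i j} → 1 ℕ.≤ i → i ℕ.≤ j → j ℕ.≤ J → N i ℕ.≤ N j)
      (parity : ∀ {j b} → 1 ℕ.≤ j → j ℕ.≤ J → Sign (G j) b → odd (N j) ≡ b) where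

      private
        -- The index `j` with its sign is carried along, because `G` may vanish at `suc (t + t)`
        -- itself and the next change has to start from a nonzero value.
        Reached : ℕ → Set
        Reached t = ∃[ j ] 1 ℕ.≤ j × j ℕ.≤ suc (t ℕ.+ t) × t ℕ.≤ N j × ∃[ b ] Sign (G j) b

        not-fixed : ∀ b → not b ≢ b
        not-fixed true  ()
        not-fixed false ()

        advance : ∀ {t} → suc (suc t ℕ.+ suc t) ℕ.≤ J → Reached t → Reached (suc t)
        advance {t} ≤J (j , 1≤j , j≤ , t≤N , b , sgn) =
          [ advance-to (ℕ.n≤1+n j) (ℕ.m≤n⇒m≤1+n (ℕ.s≤s j≤))
          , advance-to (ℕ.m≤n+m j 2) (ℕ.s≤s (ℕ.s≤s j≤))
          ]′ (sign-change sgn)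
          where
          advance-to : ∀ {i} → j ℕ.≤ i → i ℕ.≤ suc (suc (suc (t ℕ.+ t))) →
                       Sign (G i) (not b) → Reached (suc t)
          advance-to {i} j≤i i≤ sgn′ = i , 1≤i , i≤′ , ℕ.≤-<-trans t≤N N< , not b , sgn′
            where
            1≤i = ℕ.≤-trans 1≤j j≤i
            i≤′ = ℕ.≤-trans i≤ (ℕ.≤-reflexive (cong (λ m → suc (suc m)) (sym (ℕ.+-suc t t))))
            i≤J = ℕ.≤-trans i≤′ ≤J
            N< : N j ℕ.< N i
            N< = ℕ.≤∧≢⇒< (mono 1≤j j≤i i≤J) λ Nj≡Ni → not-fixed b (trans
              (sym (parity 1≤i i≤J sgn′)) (trans (cong odd (sym Nj≡Ni))
                (parity 1≤j (ℕ.≤-trans j≤i i≤J) sgn)))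

        reach : ∀ t → suc (t ℕ.+ t) ℕ.≤ J → Reached t
        -- The walk starts at 1 because `G 0` is sin 0 in the application.
        reach zero    _  = 1 , ℕ.≤-refl , ℕ.≤-refl , ℕ.z≤n , false , isPos 0<G1
        reach (suc t) ≤J = advance ≤J (reach t (ℕ.≤-trans (ℕ.s≤s (ℕ.m≤n⇒m≤1+n
          (ℕ.+-monoʳ-≤ t (ℕ.n≤1+n t)))) ≤J))

      sign-changes-≤ : ∀ t → suc (t ℕ.+ t) ℕ.≤ J → t ℕ.≤ N (suc (t ℕ.+ t))
      sign-changes-≤ t ≤J with reach t ≤J
      ... | j , 1≤j , j≤ , t≤N , _ = ℕ.≤-trans t≤N (mono 1≤j j≤ ≤J)

open RationalLemmas
open import Defs
open import Data.Nat.Properties using (≤-trans; *-monoʳ-≤; m≤n*m)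

-- The characteristic polynomial of the path at rational points

seq-∑ : ∀ {n} (f : Vector ℝ n) m → seq (∑ f) m ≡ sum λ i → seq (f i) m
seq-∑ {zero}  f m = refl
seq-∑ {suc n} f m = cong (seq (f Fin.zero) m ℚ.+_) (seq-∑ (f ∘ Fin.suc) m)

seq-∏ : ∀ {n} (f : Vector ℝ n) m → seq (∏ f) m ≡ product λ i → seq (f i) m
seq-∏ {zero}  f m = refl
seq-∏ {suc n} f m = cong (seq (f Fin.zero) m ℚ.*_) (seq-∏ (f ∘ Fin.suc) m)

seq-^ : ∀ x k m → seq (x ^ k) m ≡ seq x m ^ℚ k
seq-^ x zero    m = refl
seq-^ x (suc k) m = cong (seq x m ℚ.*_) (seq-^ x k m)

-- Real operations act index by index, so at a fixed index a determinant can be computed over ℚ,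
-- with propositional equality and the ring solver.
ℚMatrix : ℕ → Set
ℚMatrix n = Fin n → Fin n → ℚ

ℚminor : ∀ {n} → ℚMatrix (suc n) → Fin (suc n) → ℚMatrix n
ℚminor M j i = removeAt (M (Fin.suc i)) j

ℚdet : ∀ {n} → ℚMatrix n → ℚ
ℚdet {zero}  M = 1ℚ
ℚdet {suc n} M = sum λ j → ((ℚ.- 1ℚ) ^ℚ toℕ j) ℚ.* (M Fin.zero j ℚ.* ℚdet (ℚminor M j))

seq-det : ∀ {n} (M : Matrix n) m → seq (det M) m ≡ ℚdet λ i j → seq (M i j) m
seq-det {zero}  M m = refl
seq-det {suc n} M m = trans (seq-∑ {suc n} (λ j → (- 1ℝ) ^ toℕ j * (M Fin.zero j * det (minor M j))) m)
  (sum-cong-≗ {suc n} λ j →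
  cong₂ ℚ._*_ (seq-^ (- 1ℝ) (toℕ j) m)
    (cong (seq (M Fin.zero j) m ℚ.*_) (seq-det (minor M j) m)))

ℚdet-cong : ∀ {n} {M N : ℚMatrix n} → (∀ i j → M i j ≡ N i j) → ℚdet M ≡ ℚdet N
ℚdet-cong {zero}  M≡N = refl
ℚdet-cong {suc n} M≡N = sum-cong-≗ {suc n} λ j → cong ((ℚ.- 1ℚ) ^ℚ toℕ j ℚ.*_)
  (cong₂ ℚ._*_ (M≡N Fin.zero j)
    (ℚdet-cong λ i k → M≡N (Fin.suc i) (Fin.punchIn j k)))

sum-zero : ∀ {n} {f : Vector ℚ n} → (∀ i → f i ≡ 0ℚ) → sum f ≡ 0ℚ
sum-zero {n} f≡0 = trans (sum-cong-≗ f≡0) (sum-replicate-zero n)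

-- In the expansion along the first row, the term of column zero has a zero entry, and every other
-- minor inherits the zero column.
ℚdet-zero-column : ∀ {n} (M : ℚMatrix (suc n)) → (∀ i → M i Fin.zero ≡ 0ℚ) → ℚdet M ≡ 0ℚ
ℚdet-zero-column {n} M M₀≡0 = sum-zero {suc n} (term n M M₀≡0)
  where
  term : ∀ n (M : ℚMatrix (suc n)) → (∀ i → M i Fin.zero ≡ 0ℚ) → ∀ j →
         ((ℚ.- 1ℚ) ^ℚ toℕ j) ℚ.* (M Fin.zero j ℚ.* ℚdet (ℚminor M j)) ≡ 0ℚ
  term n M M₀≡0 Fin.zero =
    trans (cong (λ z → 1ℚ ℚ.* (z ℚ.* ℚdet (ℚminor M Fin.zero))) (M₀≡0 Fin.zero))
      (solve 1 (λ D → con 1ℚ :* (con 0ℚ :* D) := con 0ℚ) refl (ℚdet (ℚminor M Fin.zero)))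
  term (suc n) M M₀≡0 j@(Fin.suc _) = trans
    (cong (λ z → ((ℚ.- 1ℚ) ^ℚ toℕ j) ℚ.* (M Fin.zero j ℚ.* z))
      (ℚdet-zero-column (ℚminor M j) (M₀≡0 ∘ Fin.suc)))
    (trans (cong (((ℚ.- 1ℚ) ^ℚ toℕ j) ℚ.*_) (ℚ.*-zeroʳ (M Fin.zero j)))
           (ℚ.*-zeroʳ ((ℚ.- 1ℚ) ^ℚ toℕ j)))

-- Determinants of tridiagonal matrices.

firstUnit : ∀ {n} → Fin n → ℚ
firstUnit Fin.zero    = 1ℚ
firstUnit (Fin.suc _) = 0ℚ

-- The off-diagonal ones are the negated entries -1 of the Laplacian in `x I - L`. Recursion on both
-- indices makes the deletion of the first row and column definitional.
tridiagonal : ∀ {n} → Vector ℚ n → ℚMatrix n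
tridiagonal a Fin.zero    Fin.zero    = a Fin.zero
tridiagonal a Fin.zero    (Fin.suc j) = firstUnit j
tridiagonal a (Fin.suc i) Fin.zero    = firstUnit i
tridiagonal a (Fin.suc i) (Fin.suc j) = tridiagonal (a ∘ Fin.suc) i j

-- Only two entries of the first row are nonzero. The minor of the second has first column (1, 0,
-- ..., 0), so in its own expansion every term but the first has a minor with a zero column.
ℚdet-tridiagonal : ∀ {n} (a : Vector ℚ (suc (suc n))) →
  ℚdet (tridiagonal a) ≡ a Fin.zero ℚ.* ℚdet (tridiagonal (a ∘ Fin.suc))
                         ℚ.- ℚdet (tridiagonal (a ∘ Fin.suc ∘ Fin.suc))
ℚdet-tridiagonal {n} a = trans
  (cong₂ (λ p q → 1ℚ ℚ.* (a₀ ℚ.* D₁) ℚ.+ ((ℚ.- 1ℚ) ℚ.* 1ℚ ℚ.* (1ℚ ℚ.* p) ℚ.+ q))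
    minor₁ (sum-zero {n} λ j → trans
      (cong (s₂ j ℚ.*_) (ℚ.*-zeroˡ (ℚdet (ℚminor M (Fin.suc (Fin.suc j)))))) (ℚ.*-zeroʳ (s₂ j))))
  (solve 3 (λ a D₁ D₂ → con 1ℚ :* (a :* D₁) :+ ((:- con 1ℚ) :* con 1ℚ :* (con 1ℚ :* D₂) :+ con 0ℚ)
      := a :* D₁ :- D₂) refl a₀ D₁ D₂)
  where
  M  = tridiagonal a
  a₀ = a Fin.zero
  D₁ = ℚdet (tridiagonal (a ∘ Fin.suc))
  D₂ = ℚdet (tridiagonal (a ∘ Fin.suc ∘ Fin.suc))
  s₂ : Fin n → ℚ
  s₂ j = (ℚ.- 1ℚ) ^ℚ suc (suc (toℕ j))
  M₁ : ℚMatrix (suc n)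
  M₁ = ℚminor M (Fin.suc Fin.zero)
  minor₁ : ℚdet M₁ ≡ D₂
  minor₁ = trans
    (cong (1ℚ ℚ.* (1ℚ ℚ.* D₂) ℚ.+_) (sum-zero {n} λ j → trans
      (cong (λ z → t j ℚ.* (M₁ Fin.zero (Fin.suc j) ℚ.* z)) (zero-col j))
      (trans (cong (t j ℚ.*_) (ℚ.*-zeroʳ (M₁ Fin.zero (Fin.suc j)))) (ℚ.*-zeroʳ (t j)))))
    (solve 1 (λ D → con 1ℚ :* (con 1ℚ :* D) :+ con 0ℚ := D) refl D₂)
    where
    t : Fin n → ℚ
    t j = (ℚ.- 1ℚ) ^ℚ suc (toℕ j)
    zero-col : ∀ j → ℚdet (ℚminor M₁ (Fin.suc j)) ≡ 0ℚ
    zero-col = column n a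
      where
      column : ∀ n (a : Vector ℚ (suc (suc n))) (j : Fin n) →
               ℚdet (ℚminor (ℚminor (tridiagonal a) (Fin.suc Fin.zero)) (Fin.suc j)) ≡ 0ℚ
      column (suc n) a j = ℚdet-zero-column
        (ℚminor (ℚminor (tridiagonal a) (Fin.suc Fin.zero)) (Fin.suc j)) λ _ → refl

tridiagonal-cong : ∀ {n} {a b : Vector ℚ n} → (∀ i → a i ≡ b i) →
                   ∀ i j → tridiagonal a i j ≡ tridiagonal b i j
tridiagonal-cong a≡b Fin.zero    Fin.zero    = a≡b Fin.zero
tridiagonal-cong a≡b Fin.zero    (Fin.suc j) = refl
tridiagonal-cong a≡b (Fin.suc i) Fin.zero    = refl
tridiagonal-cong a≡b (Fin.suc i) (Fin.suc j) = tridiagonal-cong (a≡b ∘ Fin.suc) i j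

tridiagonal-diagonal : ∀ {n} (a : Vector ℚ n) i → tridiagonal a i i ≡ a i
tridiagonal-diagonal a Fin.zero    = refl
tridiagonal-diagonal a (Fin.suc i) = tridiagonal-diagonal (a ∘ Fin.suc) i

tridiagonal-adjacent : ∀ {n} (a : Vector ℚ n) i j → Adj (path n) i j → tridiagonal a i j ≡ 1ℚ
tridiagonal-adjacent a Fin.zero (Fin.suc Fin.zero) adj = refl
tridiagonal-adjacent a (Fin.suc Fin.zero) Fin.zero adj = refl
tridiagonal-adjacent a (Fin.suc i) (Fin.suc j) (inj₁ eq) =
  tridiagonal-adjacent (a ∘ Fin.suc) i j (inj₁ (ℕ.suc-injective eq))
tridiagonal-adjacent a (Fin.suc i) (Fin.suc j) (inj₂ eq) =
  tridiagonal-adjacent (a ∘ Fin.suc) i j (inj₂ (ℕ.suc-injective eq))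
tridiagonal-adjacent a Fin.zero Fin.zero (inj₁ ())
tridiagonal-adjacent a Fin.zero Fin.zero (inj₂ ())
tridiagonal-adjacent a Fin.zero (Fin.suc (Fin.suc _)) (inj₁ ())
tridiagonal-adjacent a Fin.zero (Fin.suc (Fin.suc _)) (inj₂ ())
tridiagonal-adjacent a (Fin.suc (Fin.suc _)) Fin.zero (inj₁ ())
tridiagonal-adjacent a (Fin.suc (Fin.suc _)) Fin.zero (inj₂ ())

tridiagonal-elsewhere : ∀ {n} (a : Vector ℚ n) i j → i ≢ j → ¬ Adj (path n) i j →
                        tridiagonal a i j ≡ 0ℚ
tridiagonal-elsewhere a Fin.zero Fin.zero i≢j ¬adj = ⊥-elim (i≢j refl)
tridiagonal-elsewhere a Fin.zero (Fin.suc Fin.zero) i≢j ¬adj = ⊥-elim (¬adj (inj₁ refl))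
tridiagonal-elsewhere a Fin.zero (Fin.suc (Fin.suc j)) i≢j ¬adj = refl
tridiagonal-elsewhere a (Fin.suc Fin.zero) Fin.zero i≢j ¬adj = ⊥-elim (¬adj (inj₂ refl))
tridiagonal-elsewhere a (Fin.suc (Fin.suc i)) Fin.zero i≢j ¬adj = refl
tridiagonal-elsewhere a (Fin.suc i) (Fin.suc j) i≢j ¬adj =
  tridiagonal-elsewhere (a ∘ Fin.suc) i j (i≢j ∘ cong Fin.suc)
    (¬adj ∘ Sum.map (cong suc) (cong suc))

-- Degrees of the path.

indicator : Bool → ℕ
indicator b = if b then 1 else 0

length-filter-tabulate : ∀ {A : Set} {P : Pred A 0ℓ} (P? : Decidable P) {n} (f : Fin n → A) →
  List.length (List.filter P? (List.tabulate f)) ≡ ℕsum λ i → indicator (does (P? (f i)))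
length-filter-tabulate P? {zero}  f = refl
length-filter-tabulate P? {suc n} f with does (P? (f Fin.zero))
... | true  = cong suc (length-filter-tabulate P? (f ∘ Fin.suc))
... | false = length-filter-tabulate P? (f ∘ Fin.suc)

-- In this form the degrees of the path reduce by computation on the shape of the vertex, up to a
-- sum of zeros.
degree-sum : ∀ {n} (G : SimpleGraph n) u → degree G u ≡ ℕsum λ v → indicator (does (adj? G u v))
degree-sum G u = length-filter-tabulate (adj? G u) (λ v → v)

ℕsum-zero : ∀ n → ℕsum {n} (λ _ → 0) ≡ 0
ℕsum-zero zero    = refl
ℕsum-zero (suc n) = ℕsum-zero n

degree-first : ∀ n → degree (path (suc (suc n))) Fin.zero ≡ 1
degree-first n = trans (degree-sum (path (suc (suc n))) Fin.zero) (cong suc (ℕsum-zero n))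

-- Degrees of the vertices after the first. They are unchanged when a vertex is dropped from the
-- front, which lets `ℚdet-later` recurse.
laterDegree : ∀ {n} → Fin n → ℕ
laterDegree {suc zero}    Fin.zero = 1
laterDegree {suc (suc n)} Fin.zero = 2
laterDegree (Fin.suc u)            = laterDegree u

degree-later : ∀ {n} (u : Fin n) → degree (path (suc n)) (Fin.suc u) ≡ laterDegree u
degree-later u = trans (degree-sum (path _) (Fin.suc u)) (go u)
  where
  go : ∀ {n} (u : Fin n) →
       ℕsum {suc n} (λ v → indicator (does (adj? (path (suc n)) (Fin.suc u) v))) ≡ laterDegree u
  go {suc zero}    Fin.zero = refl
  go {suc (suc n)} Fin.zero = cong (λ m → suc (suc m)) (ℕsum-zero n)
  go (Fin.suc u) = go u

degree-≤2 : ∀ {n} (u : Fin n) → degree (path n) u ℕ.≤ 2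
degree-≤2 {suc zero}    Fin.zero = ℕ.z≤n
degree-≤2 {suc (suc n)} Fin.zero = ℕ.≤-trans (ℕ.≤-reflexive (degree-first n)) (ℕ.n≤1+n 1)
degree-≤2 (Fin.suc u) = ℕ.≤-trans (ℕ.≤-reflexive (degree-later u)) (go u)
  where
  go : ∀ {n} (u : Fin n) → laterDegree u ℕ.≤ 2
  go {suc zero}    Fin.zero = ℕ.n≤1+n 1
  go {suc (suc n)} Fin.zero = ℕ.≤-refl
  go (Fin.suc u) = go u

d-≤2 : ∀ {n} (i : Fin n) → d (path n) i ℕ.≤ 2
d-≤2 {n} i = All.lookup {P = ℕ._≤ 2} (All-resp-↭ (↭-sym (sort↓-↭ (degreeList (path n))))
    (All.map⁺ (All.tabulate⁺ {n = n} degree-≤2)))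
  (∈-lookup (Fin.cast (sym (degreeList-length (path n))) i))

-- The characteristic polynomial through continuants.

ι : ℕ → ℚ
ι n = ℤ.+ n ℚ./ 1

charpoly-entry : ∀ {n} (G : SimpleGraph n) q (T : ℚMatrix n) →
  (∀ u → T u u ≡ q ℚ.- ι (degree G u)) →
  (∀ u v → Adj G u v → T u v ≡ 1ℚ) →
  (∀ u v → u ≢ v → ¬ Adj G u v → T u v ≡ 0ℚ) →
  ∀ u v m → seq (scalar (fromℚ q) u v - laplacian G u v) m ≡ T u v
charpoly-entry G q T diagonal adjacent elsewhere u v m with u Fin.≟ v
... | yes refl = sym (diagonal u)
... | no  u≢v with adj? G u v
...   | yes adj  = sym (adjacent u v adj)
...   | no  ¬adj = sym (elsewhere u v u≢v ¬adj)

charpoly-path-entry : ∀ {n} q (u v : Fin n) m →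
  seq (scalar (fromℚ q) u v - laplacian (path n) u v) m
  ≡ tridiagonal (λ u → q ℚ.- ι (degree (path n) u)) u v
charpoly-path-entry {n} q = charpoly-entry (path n) q (tridiagonal a)
  (tridiagonal-diagonal a) (tridiagonal-adjacent a) (tridiagonal-elsewhere a)
  where
  a : Vector ℚ n
  a u = q ℚ.- ι (degree (path n) u)

-- The determinant of the block of `q I - L` left after deleting initial vertices: the end vertex
-- has degree 1, the others in the block degree 2.
continuant : ℚ → ℕ → ℚ
continuant q zero          = 1ℚ
continuant q (suc zero)    = q ℚ.- 1ℚ
continuant q (suc (suc n)) = (q ℚ.- ι 2) ℚ.* continuant q (suc n) ℚ.- continuant q n

ℚdet-later : ∀ q n → ℚdet (tridiagonal {n} (λ u → q ℚ.- ι (laterDegree u))) ≡ continuant q n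
ℚdet-later q zero          = refl
ℚdet-later q (suc zero)    =
  solve 1 (λ a → con 1ℚ :* (a :* con 1ℚ) :+ con 0ℚ := a) refl (q ℚ.- 1ℚ)
ℚdet-later q (suc (suc n)) = trans (ℚdet-tridiagonal {n} (λ u → q ℚ.- ι (laterDegree u)))
  (cong₂ (λ y z → (q ℚ.- ι 2) ℚ.* y ℚ.- z) (ℚdet-later q (suc n)) (ℚdet-later q n))

-- The first vertex is an end as well, hence `q - 1ℚ` instead of `q - ι 2` in the last step of the
-- recurrence.
charpoly-path : ∀ n q m →
  seq (charpoly (laplacian (path (suc (suc n)))) (fromℚ q)) m
  ≡ (q ℚ.- 1ℚ) ℚ.* continuant q (suc n) ℚ.- continuant q n
charpoly-path n q m = begin
  seq (charpoly (laplacian (path (suc (suc n)))) (fromℚ q)) m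
    ≡⟨ seq-det (λ i j → scalar (fromℚ q) i j - laplacian (path (suc (suc n))) i j) m ⟩
  ℚdet (λ i j → seq (scalar (fromℚ q) i j - laplacian (path (suc (suc n))) i j) m)
    ≡⟨ ℚdet-cong {suc (suc n)}
         {λ i j → seq (scalar (fromℚ q) i j - laplacian (path (suc (suc n))) i j) m} {tridiagonal a}
         (λ i j → charpoly-path-entry q i j m) ⟩
  ℚdet (tridiagonal a)
    ≡⟨ ℚdet-tridiagonal a ⟩
  a Fin.zero ℚ.* ℚdet (tridiagonal (a ∘ Fin.suc)) ℚ.- ℚdet (tridiagonal (a ∘ Fin.suc ∘ Fin.suc))
    ≡⟨ cong₂ (λ y z → a Fin.zero ℚ.* y ℚ.- z)
         (trans (ℚdet-cong {suc n} (tridiagonal-cong later)) (ℚdet-later q (suc n)))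
         (trans (ℚdet-cong {n} (tridiagonal-cong (later ∘ Fin.suc))) (ℚdet-later q n)) ⟩
  a Fin.zero ℚ.* continuant q (suc n) ℚ.- continuant q n
    ≡⟨ cong (λ k → (q ℚ.- ι k) ℚ.* continuant q (suc n) ℚ.- continuant q n) (degree-first n) ⟩
  (q ℚ.- 1ℚ) ℚ.* continuant q (suc n) ℚ.- continuant q n ∎
  where
  open ≡-Reasoning
  a : Vector ℚ (suc (suc n))
  a u = q ℚ.- ι (degree (path (suc (suc n))) u)
  later : ∀ u → a (Fin.suc u) ≡ q ℚ.- ι (laterDegree u)
  later u = cong (λ k → q ℚ.- ι k) (degree-later u)

-- Sample points near 4

module _ (c s : ℚ) (c²+s²≡1 : c ℚ.* c ℚ.+ s ℚ.* s ≡ 1ℚ) where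
  open Rotation c s

  -- The substitution 2 + 2 cos φ turns the characteristic polynomial into a
  -- Chebyshev polynomial of the second kind.
  2+2cos : ℕ → ℚ
  2+2cos l = (1ℚ ℚ.+ cos l) ℚ.+ (1ℚ ℚ.+ cos l)

  -- At x = 2 + 2 cos φ the factor x - 2 is 2 cos φ, so both sides satisfy the recurrence of
  -- `sin-three-term` and agree at two initial values.
  continuant-sin : ∀ l m → continuant (2+2cos l) m ℚ.* sin l
                           ≡ sin (suc m ℕ.* l) ℚ.+ sin (m ℕ.* l)
  continuant-sin l zero = trans (ℚ.*-identityˡ (sin l))
    (trans (cong sin (sym (ℕ.+-identityʳ l))) (sym (ℚ.+-identityʳ (sin (l ℕ.+ 0)))))
  continuant-sin l (suc zero) = trans
    (solve 2 (λ C S → (((con 1ℚ :+ C) :+ (con 1ℚ :+ C)) :- con 1ℚ) :* S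
                      := ((C :+ C) :* S :- con 0ℚ) :+ S) refl (cos l) (sin l))
    (trans (cong (λ z → ((cos l ℚ.+ cos l) ℚ.* z ℚ.- 0ℚ) ℚ.+ z)
                 (cong sin (sym (ℕ.+-identityʳ l))))
           (cong (ℚ._+ sin (l ℕ.+ 0)) (sym (sin-three-term c²+s²≡1 l 0))))
  continuant-sin l (suc (suc m)) = trans
    (solve 4 (λ C S F F′ → ((((con 1ℚ :+ C) :+ (con 1ℚ :+ C)) :- con (ι 2)) :* F′ :- F) :* S
        := (C :+ C) :* (F′ :* S) :- F :* S) refl
      (cos l) (sin l) (continuant (2+2cos l) m) (continuant (2+2cos l) (suc m)))
    (trans (cong₂ (λ y z → (cos l ℚ.+ cos l) ℚ.* y ℚ.- z)
             (continuant-sin l (suc m)) (continuant-sin l m))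
      (trans (solve 4 (λ C S₂ S₁ S₀ → (C :+ C) :* (S₂ :+ S₁) :- (S₁ :+ S₀)
          := ((C :+ C) :* S₂ :- S₁) :+ ((C :+ C) :* S₁ :- S₀)) refl
          (cos l) (sin (suc (suc m) ℕ.* l)) (sin (suc m ℕ.* l)) (sin (m ℕ.* l)))
        (sym (cong₂ ℚ._+_ (sin-three-term c²+s²≡1 l (suc m ℕ.* l))
                          (sin-three-term c²+s²≡1 l (m ℕ.* l))))))

  -- With S₂ + S₀ = (x - 2) S₁ for three consecutive sines, (x - 1) (S₂ + S₁) - (S₁ + S₀) collapses
  -- to x S₂.
  charpoly-sin : ∀ l m →
    ((2+2cos l ℚ.- 1ℚ) ℚ.* continuant (2+2cos l) (suc m) ℚ.- continuant (2+2cos l) m) ℚ.* sin l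
    ≡ 2+2cos l ℚ.* sin (suc (suc m) ℕ.* l)
  charpoly-sin l m = trans
    (solve 4 (λ x S F F′ → ((x :- con 1ℚ) :* F′ :- F) :* S
        := (x :- con 1ℚ) :* (F′ :* S) :- F :* S) refl
      (2+2cos l) (sin l) (continuant (2+2cos l) m) (continuant (2+2cos l) (suc m)))
    (trans (cong₂ (λ y z → (2+2cos l ℚ.- 1ℚ) ℚ.* y ℚ.- z)
             (continuant-sin l (suc m)) (continuant-sin l m))
      (trans (cong (λ z → (2+2cos l ℚ.- 1ℚ) ℚ.* (z ℚ.+ sin (suc m ℕ.* l))
                          ℚ.- (sin (suc m ℕ.* l) ℚ.+ sin (m ℕ.* l)))
               (sin-three-term c²+s²≡1 l (m ℕ.* l)))
        (trans (solve 3 (λ C S₁ S₀ →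
            (((con 1ℚ :+ C) :+ (con 1ℚ :+ C)) :- con 1ℚ) :* (((C :+ C) :* S₁ :- S₀) :+ S₁) :- (S₁ :+ S₀)
            := ((con 1ℚ :+ C) :+ (con 1ℚ :+ C)) :* ((C :+ C) :* S₁ :- S₀)) refl
            (cos l) (sin (suc m ℕ.* l)) (sin (m ℕ.* l)))
          (cong (2+2cos l ℚ.*_) (sym (sin-three-term c²+s²≡1 l (m ℕ.* l)))))))

-- The angle is 2 arctan (1 / 2n), a rational point of the unit circle; n times
-- it is just below 1, which exceeds π / 4.
module Angle (n-1 : ℕ) where

  n = suc n-1

  b = proj₁ (·-÷ n-1 {½} (ℚ.positive⁻¹ ½))

  0<b : 0ℚ ℚ.< b
  0<b = proj₁ (proj₂ (·-÷ n-1 {½} (ℚ.positive⁻¹ ½)))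

  nb≡½ : n · b ≡ ½
  nb≡½ = proj₂ (proj₂ (·-÷ n-1 {½} (ℚ.positive⁻¹ ½)))

  0≤b = ℚ.<⇒≤ 0<b

  private
    1+b² = 1ℚ ℚ.+ b ℚ.* b
    0≤b² = 0≤*0≤ {b} {b} 0≤b 0≤b
    instance
      1+b²-pos : ℚ.Positive 1+b²
      1+b²-pos = ℚ.positive (0<+0≤ {1ℚ} {b ℚ.* b} (ℚ.positive⁻¹ 1ℚ) 0≤b²)
      1+b²-nonZero : ℚ.NonZero 1+b²
      1+b²-nonZero = ℚ.pos⇒nonZero 1+b²

  -- `b` is the tangent of the half angle and `r` the square of its cosine; `c` and `s` are the
  -- double-angle formulas.
  r = ℚ.1/ 1+b²
  c = r ℚ.+ r ℚ.- 1ℚ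
  s = (b ℚ.+ b) ℚ.* r

  0<r : 0ℚ ℚ.< r
  0<r = ℚ.positive⁻¹ r {{ℚ.1/pos⇒pos 1+b²}}

  private
    0≤r = ℚ.<⇒≤ 0<r

    r[1+b²]≡1 : r ℚ.* 1+b² ≡ 1ℚ
    r[1+b²]≡1 = ℚ.*-inverseˡ 1+b²

    1-r : 1ℚ ℚ.- r ≡ b ℚ.* b ℚ.* r
    1-r = trans (cong (ℚ._- r) (sym r[1+b²]≡1))
      (solve 2 (λ b r → r :* (con 1ℚ :+ b :* b) :- r := b :* b :* r) refl b r)

    0≤b²r = 0≤*0≤ {b ℚ.* b} {r} 0≤b² 0≤r

    0≤1-r : 0ℚ ℚ.≤ 1ℚ ℚ.- r
    0≤1-r = subst (0ℚ ℚ.≤_) (sym 1-r) 0≤b²r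

    b≤½ : b ℚ.≤ ½
    b≤½ = subst (b ℚ.≤_) nb≡½ (p+r≡q⇒p≤q {b} {n · b} {n-1 · b} refl (·-nonNeg n-1 0≤b))

  c²+s²≡1 : c ℚ.* c ℚ.+ s ℚ.* s ≡ 1ℚ
  c²+s²≡1 = trans
    (solve 2 (λ b r → (r :+ r :- con 1ℚ) :* (r :+ r :- con 1ℚ) :+ ((b :+ b) :* r) :* ((b :+ b) :* r)
      := con 1ℚ :+ con (ι 4) :* r :* (r :* (con 1ℚ :+ b :* b) :- con 1ℚ)) refl b r)
    (trans (cong (λ z → 1ℚ ℚ.+ ι 4 ℚ.* r ℚ.* (z ℚ.- 1ℚ)) r[1+b²]≡1)
      (solve 1 (λ r → con 1ℚ :+ con (ι 4) :* r :* (con 1ℚ :- con 1ℚ) := con 1ℚ) refl r))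

  0<s : 0ℚ ℚ.< s
  0<s = 0<*0< {b ℚ.+ b} {r} (0<+0≤ {b} {b} 0<b 0≤b) 0<r

  s≤2b : s ℚ.≤ b ℚ.+ b
  s≤2b = p+r≡q⇒p≤q
    (solve 2 (λ b r → (b :+ b) :* r :+ (b :+ b) :* (con 1ℚ :- r) := b :+ b) refl b r)
    (0≤*0≤ {b ℚ.+ b} {1ℚ ℚ.- r} (0≤+0≤ {b} {b} 0≤b 0≤b) 0≤1-r)

  c≤r : c ℚ.≤ r
  c≤r = p+r≡q⇒p≤q (solve 1 (λ r → (r :+ r :- con 1ℚ) :+ (con 1ℚ :- r) := r) refl r) 0≤1-r

  c≤1 : c ℚ.≤ 1ℚ
  c≤1 = ℚ.≤-trans c≤r (p+r≡q⇒p≤q (solve 1 (λ r → r :+ (con 1ℚ :- r) := con 1ℚ) refl r) 0≤1-r)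

  -- `1 - c` equals `2 b² r`, and `r ≤ 1`.
  1≤c+2b² : 1ℚ ℚ.≤ c ℚ.+ (b ℚ.* b ℚ.+ b ℚ.* b)
  1≤c+2b² = p+r≡q⇒p≤q
    (trans (cong (λ z → 1ℚ ℚ.+ (b ℚ.* b ℚ.* z ℚ.+ b ℚ.* b ℚ.* z)) (sym 1-r))
      (trans (solve 2 (λ b r → con 1ℚ :+ (b :* b :* (con 1ℚ :- r) :+ b :* b :* (con 1ℚ :- r))
          := (con 1ℚ :- (b :* b :* r :+ b :* b :* r)) :+ (b :* b :+ b :* b)) refl b r)
        (trans (cong (λ z → (1ℚ ℚ.- (z ℚ.+ z)) ℚ.+ (b ℚ.* b ℚ.+ b ℚ.* b)) (sym 1-r))
          (solve 2 (λ b r → (con 1ℚ :- ((con 1ℚ :- r) :+ (con 1ℚ :- r))) :+ (b :* b :+ b :* b)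
            := (r :+ r :- con 1ℚ) :+ (b :* b :+ b :* b)) refl b r))))
    (0≤+0≤ {b²·b²r} {b²·b²r} 0≤b²·b²r 0≤b²·b²r)
    where
    b²·b²r = b ℚ.* b ℚ.* (b ℚ.* b ℚ.* r)
    0≤b²·b²r = 0≤*0≤ {b ℚ.* b} {b ℚ.* b ℚ.* r} 0≤b² 0≤b²r

  0<c : 0ℚ ℚ.< c
  0<c = ℚ.<-≤-trans (ℚ.positive⁻¹ ½) (p+r≡q⇒p≤q
    (solve 2 (λ b c → con ½ :+ ((c :+ (b :* b :+ b :* b) :- con 1ℚ)
                     :+ ((con ½ :- b) :* (b :+ con ½) :+ (con ½ :- b) :* (b :+ con ½)))
        := c) refl b c)
    (0≤+0≤ {c ℚ.+ (b ℚ.* b ℚ.+ b ℚ.* b) ℚ.- 1ℚ} {q ℚ.+ q} (p≤q⇒0≤q-p 1≤c+2b²)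
      (0≤+0≤ {q} {q} 0≤q 0≤q)))
    where
    q = (½ ℚ.- b) ℚ.* (b ℚ.+ ½)
    0≤q = 0≤*0≤ {½ ℚ.- b} {b ℚ.+ ½} (p≤q⇒0≤q-p b≤½)
            (0≤+0≤ {b} {½} 0≤b (ℚ.nonNegative⁻¹ ½))

  c≤ns : c ℚ.≤ n · s
  c≤ns = ℚ.≤-trans c≤r (ℚ.≤-reflexive (sym (begin
    n · s                           ≡⟨ ·≡* n s ⟩
    (n · 1ℚ) ℚ.* ((b ℚ.+ b) ℚ.* r)  ≡⟨ solve 3 (λ k b r → k :* ((b :+ b) :* r)
                                         := (k :* b :+ k :* b) :* r) refl (n · 1ℚ) b r ⟩
    ((n · 1ℚ) ℚ.* b ℚ.+ (n · 1ℚ) ℚ.* b) ℚ.* r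
                                    ≡⟨ cong (λ z → (z ℚ.+ z) ℚ.* r) (trans (sym (·≡* n b)) nb≡½) ⟩
    (½ ℚ.+ ½) ℚ.* r                 ≡⟨ ℚ.*-identityˡ r ⟩
    r ∎)))
    where open ≡-Reasoning

path-charpoly : ℕ → ℚ → ℚ
path-charpoly n q = seq (charpoly (laplacian (path n)) (fromℚ q)) 0

seq-path-charpoly : ∀ n q m →
  seq (charpoly (laplacian (path (suc (suc n)))) (fromℚ q)) m ≡ path-charpoly (suc (suc n)) q
seq-path-charpoly n q m = trans (charpoly-path n q m) (sym (charpoly-path n q 0))

-- Sign changes of the characteristic polynomial at the samples.

module Samples (n-2 : ℕ) where
  open Angle (suc n-2) public
  open Rotation c s
  open Estimates {b} {n} 0≤b 0<s s≤2b 0<c c≤1 1≤c+2b² nb≡½ c≤ns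

  -- The multiples of θ are even so that `G` advances by 2nθ, whose cosine is nonpositive.
  sample : ℕ → ℚ
  sample j = 2+2cos c s c²+s²≡1 (j ℕ.+ j)

  sample-anti : ∀ {i j} → i ℕ.≤ j → j ℕ.+ j ℕ.≤ n → sample j ℚ.≤ sample i
  sample-anti {i} {j} i≤j 2j≤n = ℚ.+-mono-≤ le le
    where
    le = ℚ.+-monoʳ-≤ 1ℚ (cos-anti (ℕ.≤⇒≤′ (ℕ.+-mono-≤ i≤j i≤j)) 2j≤n)

  4≤sample : ∀ {j} → j ℕ.+ j ℕ.≤ n → ι 4 ℚ.≤ sample j ℚ.+ (j ℕ.+ j ℕ.+ (j ℕ.+ j)) · b
  4≤sample {j} 2j≤n = subst (ι 4 ℚ.≤_)
    (trans (solve 2 (λ C t → (con 1ℚ :+ (C :+ t)) :+ (con 1ℚ :+ (C :+ t))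
             := ((con 1ℚ :+ C) :+ (con 1ℚ :+ C)) :+ (t :+ t)) refl (cos (j ℕ.+ j)) ((j ℕ.+ j) · b))
      (cong (sample j ℚ.+_) (sym (·-homo-+ b (j ℕ.+ j) (j ℕ.+ j)))))
    (ℚ.+-mono-≤ le le)
    where
    le : 1ℚ ℚ.+ 1ℚ ℚ.≤ 1ℚ ℚ.+ (cos (j ℕ.+ j) ℚ.+ (j ℕ.+ j) · b)
    le = ℚ.+-monoʳ-≤ 1ℚ (1≤cos+2mb 2j≤n)

  G : ℕ → ℚ
  G j = sin (j ℕ.* (n ℕ.+ n))

  G-rec : ∀ j → G (suc (suc j)) ≡ (cos (n ℕ.+ n) ℚ.+ cos (n ℕ.+ n)) ℚ.* G (suc j) ℚ.- G j
  G-rec j = sin-three-term c²+s²≡1 (n ℕ.+ n) (j ℕ.* (n ℕ.+ n))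

  0<G1 : 0ℚ ℚ.< G 1
  0<G1 = subst (λ m → 0ℚ ℚ.< sin m) (sym (ℕ.+-identityʳ (n ℕ.+ n))) 0<sin[2n]

  -- In `charpoly-sin` both `sample j` and sin (2jθ) are positive for these `j`; at `j = 0` the sine
  -- would vanish.
  sign-charpoly : ∀ {j β} → 1 ℕ.≤ j → j ℕ.+ j ℕ.≤ n → Sign (G j) β →
                  Sign (path-charpoly n (sample j)) β
  sign-charpoly {j@(suc _)} {β} 1≤j 2j≤n sgn = Sign-*⁻ (0<sin 2j≤n)
    (subst (λ p → Sign p β) eq (Sign-* 0<sample sgn))
    where
    0<1+cos : 0ℚ ℚ.< 1ℚ ℚ.+ cos (j ℕ.+ j)
    0<1+cos = 0<+0≤ {1ℚ} {cos (j ℕ.+ j)} (ℚ.positive⁻¹ 1ℚ) (ℚ.<⇒≤ (0<cos 2j≤n))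
    0<sample : 0ℚ ℚ.< sample j
    0<sample = 0<+0≤ {1ℚ ℚ.+ cos (j ℕ.+ j)} {1ℚ ℚ.+ cos (j ℕ.+ j)} 0<1+cos (ℚ.<⇒≤ 0<1+cos)
    ℕeq : j ℕ.* (n ℕ.+ n) ≡ n ℕ.* (j ℕ.+ j)
    ℕeq = ℕ-Solver.solve 2 (λ j n → j ℕ-Solver.:* (n ℕ-Solver.:+ n)
            ℕ-Solver.:= n ℕ-Solver.:* (j ℕ-Solver.:+ j)) refl j n
    eq : sample j ℚ.* G j ≡ sin (j ℕ.+ j) ℚ.* path-charpoly n (sample j)
    eq = trans (cong (λ m → sample j ℚ.* sin m) ℕeq)
      (trans (sym (charpoly-sin c s c²+s²≡1 (j ℕ.+ j) n-2))
        (trans (ℚ.*-comm _ (sin (j ℕ.+ j)))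
          (cong (sin (j ℕ.+ j) ℚ.*_) (sym (charpoly-path n-2 (sample j) 0)))))

  κ≤0 : cos (n ℕ.+ n) ℚ.+ cos (n ℕ.+ n) ℚ.≤ 0ℚ
  κ≤0 = ℚ.+-mono-≤ cos[2n]≤0 cos[2n]≤0

  open Oscillation G κ≤0 G-rec

  -- `same-sign` is how the factorisation enters: at a late index the product over rational
  -- approximations keeps the sign of the characteristic polynomial at each sample.
  ≤-#above : ∀ {J} (μ : Vector ℚ n) → J ℕ.+ J ℕ.≤ n →
    (∀ j {β} → j ℕ.≤ J → Sign (path-charpoly n (sample j)) β →
                     Sign (product λ i → sample j ℚ.- μ i) β) →
    ∀ k → suc (k ℕ.+ k) ℕ.≤ J → k ℕ.≤ #above (sample (suc (k ℕ.+ k))) μ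
  ≤-#above {J} μ 2J≤n same-sign = sign-changes-≤ 0<G1 (λ j → #above (sample j) μ)
    (λ _ i≤j j≤J → #above-anti μ (sample-anti i≤j (double j≤J)))
    (λ {j} 1≤j j≤J sgn → #above-parity (sample j) μ
      (same-sign j j≤J (sign-charpoly 1≤j (double j≤J) sgn)))
    where
    double : ∀ {j} → j ℕ.≤ J → j ℕ.+ j ℕ.≤ n
    double j≤J = ℕ.≤-trans (ℕ.+-mono-≤ j≤J j≤J) 2J≤n

  -- The count puts at least k entries above the sample 1 + 2k, so an entry of
  -- index below k far under it would be too small for the almost-ordering.
  ≤-entry : ∀ {J δ} (μ : Vector ℚ n) → J ℕ.+ J ℕ.≤ n →
    (J ℕ.+ J ℕ.+ (J ℕ.+ J)) · b ℚ.≤ δ →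
    (∀ i i′ → toℕ i ℕ.≤ toℕ i′ → μ i′ ℚ.≤ μ i ℚ.+ δ) →
    (∀ j {β} → j ℕ.≤ J → Sign (path-charpoly n (sample j)) β →
                     Sign (product λ i → sample j ℚ.- μ i) β) →
    ∀ k → suc (k ℕ.+ k) ℕ.≤ J → ∀ i → toℕ i ℕ.< k → ι 4 ℚ.- δ ℚ.- δ ℚ.≤ μ i
  ≤-entry {J} {δ} μ 2J≤n 4Jb≤δ decreasing same-sign k j≤J i i<k = ℚ.≮⇒≥ λ μ<B →
    ℕ.<⇒≱ i<k (ℕ.≤-trans (≤-#above μ 2J≤n same-sign k j≤J)
      (#above-≤ x μ (toℕ i) λ i′ i≤i′ → ℚ.≤-trans (decreasing i i′ i≤i′)
        (ℚ.≤-trans (ℚ.+-monoˡ-≤ δ (ℚ.<⇒≤ μ<B)) B+δ≤x)))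
    where
    j = suc (k ℕ.+ k)
    x = sample j
    2j≤2J = ℕ.+-mono-≤ j≤J j≤J
    4≤x+δ : ι 4 ℚ.≤ x ℚ.+ δ
    4≤x+δ = ℚ.≤-trans (4≤sample {j} (ℕ.≤-trans 2j≤2J 2J≤n))
      (ℚ.+-monoʳ-≤ x (ℚ.≤-trans (·-monoˡ-≤ 0≤b (ℕ.+-mono-≤ 2j≤2J 2j≤2J)) 4Jb≤δ))
    B+δ≤x : (ι 4 ℚ.- δ ℚ.- δ) ℚ.+ δ ℚ.≤ x
    B+δ≤x = p+r≡q⇒p≤q
      (solve 2 (λ x δ → ((con (ι 4) :- δ :- δ) :+ δ) :+ ((x :+ δ) :- con (ι 4)) := x) refl x δ)
      (p≤q⇒0≤q-p 4≤x+δ)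

-- Late indices of the Cauchy sequences.

Eventually : (ℕ → Set) → Set
Eventually P = ∃[ N ] ∀ m → N ℕ.≤ m → P m

module _ {P Q : ℕ → Set} where
  eventually-map : (∀ {m} → P m → Q m) → Eventually P → Eventually Q
  eventually-map f (N , p) = N , λ m N≤m → f (p m N≤m)

  eventually-× : Eventually P → Eventually Q → Eventually (λ m → P m × Q m)
  eventually-× (M , p) (N , q) = M ℕ.⊔ N , λ m ≤m →
    p m (ℕ.m⊔n≤o⇒m≤o M N ≤m) , q m (ℕ.m⊔n≤o⇒n≤o M N ≤m)

eventually-∀ : ∀ {n} {P : Fin n → ℕ → Set} → (∀ i → Eventually (P i)) →
               Eventually (λ m → ∀ i → P i m)
eventually-∀ {zero}  p = 0 , λ _ _ ()
eventually-∀ {suc n} p with p Fin.zero | eventually-∀ (p ∘ Fin.suc)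
... | M , p₀ | N , ps = M ℕ.⊔ N , λ where
  m ≤m Fin.zero    → p₀ m (ℕ.m⊔n≤o⇒m≤o M N ≤m)
  m ≤m (Fin.suc i) → ps m (ℕ.m⊔n≤o⇒n≤o M N ≤m) i

p≤∣p∣ : ∀ p → p ℚ.≤ ℚ.∣ p ∣
p≤∣p∣ p with ℚ.≤-total 0ℚ p
... | inj₁ 0≤p = ℚ.≤-reflexive (sym (ℚ.0≤p⇒∣p∣≡p 0≤p))
... | inj₂ p≤0 = ℚ.≤-trans p≤0 (ℚ.0≤∣p∣ p)

∣p-q∣<p⇒0<q : ∀ {p q} → ℚ.∣ p ℚ.- q ∣ ℚ.< p → 0ℚ ℚ.< q
∣p-q∣<p⇒0<q {p} {q} h = p+r≡q⇒p<q
  (solve 2 (λ p q → con 0ℚ :+ (p :- (p :- q)) := q) refl p q)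
  (p<q⇒0<q-p (ℚ.≤-<-trans (p≤∣p∣ (p ℚ.- q)) h))

-- The absolute value of `p` is the tolerance: anything closer to `p` than that shares its sign. For
-- `p` zero there is no sign to preserve.
eventually-sign : ∀ {x y p} → (∀ m → seq x m ≡ p) → x ≈ y →
                  Eventually (λ m → ∀ {β} → Sign p β → Sign (seq y m) β)
eventually-sign {x} {y} {p} x≡p x≈y with ℚ.<-cmp 0ℚ p
... | tri≈ _ refl _ = 0 , λ _ _ sgn → ⊥-elim (Sign-0 sgn)
... | tri< 0<p _ _ = eventually-map (λ {m} h → λ where
        (isPos _)   → isPos (∣p-q∣<p⇒0<q (subst (λ z → ℚ.∣ z ℚ.- seq y m ∣ ℚ.< p) (x≡p m) h))
        (isNeg p<0) → ⊥-elim (ℚ.<-asym 0<p p<0))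
      (x≈y p 0<p)
... | tri> _ _ p<0 = eventually-map (λ {m} h → λ where
        (isPos 0<p) → ⊥-elim (ℚ.<-asym 0<p p<0)
        (isNeg _)   → isNeg (neg-cancel (∣p-q∣<p⇒0<q (subst (ℚ._< ℚ.- p) (trans
          (cong (λ z → ℚ.∣ z ℚ.- seq y m ∣) (x≡p m))
          (trans (sym (ℚ.∣-p∣≡∣p∣ (p ℚ.- seq y m)))
            (cong ℚ.∣_∣ (ℚ.neg-distrib-+ p (ℚ.- seq y m))))) h))))
      (x≈y (ℚ.- p) (ℚ.neg-antimono-< p<0))
  where
  neg-cancel : ∀ {q} → 0ℚ ℚ.< ℚ.- q → q ℚ.< 0ℚ
  neg-cancel {q} 0<-q = p+r≡q⇒p<q (ℚ.+-inverseʳ q) 0<-q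

sum-≤ : ∀ {n B} {f : Vector ℚ n} → (∀ i → f i ℚ.≤ B) → sum f ℚ.≤ n · B
sum-≤ {zero}  f≤B = ℚ.≤-refl
sum-≤ {suc n} f≤B = ℚ.+-mono-≤ (f≤B Fin.zero) (sum-≤ (f≤B ∘ Fin.suc))

≤-sum : ∀ {n B} {f : Vector ℚ n} → (∀ i → B ℚ.≤ f i) → n · B ℚ.≤ sum f
≤-sum {zero}  B≤f = ℚ.≤-refl
≤-sum {suc n} B≤f = ℚ.+-mono-≤ (B≤f Fin.zero) (≤-sum (B≤f ∘ Fin.suc))

ι-≤2 : ∀ {m} → m ℕ.≤ 2 → ι m ℚ.≤ ι 2
ι-≤2 {0} _ = ℚ.≤ᵇ⇒≤ _
ι-≤2 {1} _ = ℚ.≤ᵇ⇒≤ _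
ι-≤2 {2} _ = ℚ.≤-refl
ι-≤2 {suc (suc (suc _))} (ℕ.s≤s (ℕ.s≤s ()))


-- The degrees contribute at most 4k and the eigenvalues at least k (4 - 2δ), leaving 2kδ. The
-- additional `δ` is the gap that `_<_` on the reals demands.
sum-bound : ∀ k {δ} {f : Vector ℚ (2 ℕ.* k)} {g : Vector ℚ k} →
  (∀ i → f i ℚ.≤ ι 2) → (∀ i → ι 4 ℚ.- δ ℚ.- δ ℚ.≤ g i) →
  (sum f ℚ.- sum g) ℚ.+ δ ℚ.≤ suc (k ℕ.+ k) · δ
sum-bound k {δ} {f} {g} f≤2 4-2δ≤g = begin
  (sum f ℚ.- sum g) ℚ.+ δ
    ≤⟨ ℚ.+-monoˡ-≤ δ (ℚ.+-mono-≤ (sum-≤ {2 ℕ.* k} {ι 2} f≤2)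
         (ℚ.neg-antimono-≤ (≤-sum {k} {B} 4-2δ≤g))) ⟩
  (2 ℕ.* k) · ι 2 ℚ.- k · B ℚ.+ δ
    ≡⟨ cong₂ (λ y z → y ℚ.- z ℚ.+ δ) (·≡* (2 ℕ.* k) (ι 2)) (·≡* k B) ⟩
  ((2 ℕ.* k) · 1ℚ) ℚ.* ι 2 ℚ.- (k · 1ℚ) ℚ.* B ℚ.+ δ
    ≡⟨ cong (λ y → y ℚ.* ι 2 ℚ.- (k · 1ℚ) ℚ.* B ℚ.+ δ)
         (trans (·-homo-+ 1ℚ k (k ℕ.+ 0)) (cong (λ z → k · 1ℚ ℚ.+ z · 1ℚ) (ℕ.+-identityʳ k))) ⟩
  (k · 1ℚ ℚ.+ k · 1ℚ) ℚ.* ι 2 ℚ.- (k · 1ℚ) ℚ.* B ℚ.+ δ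
    ≡⟨ solve 2 (λ K δ → (K :+ K) :* con (ι 2) :- K :* (con (ι 4) :- δ :- δ) :+ δ
         := (con 1ℚ :+ (K :+ K)) :* δ) refl (k · 1ℚ) δ ⟩
  (1ℚ ℚ.+ (k · 1ℚ ℚ.+ k · 1ℚ)) ℚ.* δ
    ≡⟨ cong (λ z → (1ℚ ℚ.+ z) ℚ.* δ) (·-homo-+ 1ℚ k k) ⟨
  (suc (k ℕ.+ k) · 1ℚ) ℚ.* δ
    ≡⟨ ·≡* (suc (k ℕ.+ k)) δ ⟨
  suc (k ℕ.+ k) · δ ∎
  where
  open ℚ.≤-Reasoning
  B = ι 4 ℚ.- δ ℚ.- δ

-- The large eigenvalues are near 4.

module _ {n-2 J δ} (0<δ : 0ℚ ℚ.< δ) (2J≤n : J ℕ.+ J ℕ.≤ suc (suc n-2))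
  (4Jb≤δ : (J ℕ.+ J ℕ.+ (J ℕ.+ J)) · Angle.b (suc n-2) ℚ.≤ δ) where

  open Samples n-2 using (sample; ≤-entry)

  -- The order of each pair of eigenvalues and the signs at the samples up to `J` are finitely many
  -- conditions, so they hold together at all late indices, where `≤-entry` applies.
  eventually-≤-eigenvalue : ∀ {λs} → IsSpectrum (laplacian (path (suc (suc n-2)))) λs →
    ∀ k → suc (k ℕ.+ k) ℕ.≤ J →
    Eventually λ m → ∀ i → toℕ i ℕ.< k → ι 4 ℚ.- δ ℚ.- δ ℚ.≤ seq (λs i) m
  eventually-≤-eigenvalue {λs} spectrum k j≤J = eventually-map
    (λ {m} (decreasing-m , signs-m) → ≤-entry {J} (λ i → seq (λs i) m) 2J≤n 4Jb≤δ decreasing-m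
      (λ j {β} j≤J → subst (Agree m β) (Fin.toℕ-fromℕ< (ℕ.s≤s j≤J))
                       (signs-m (Fin.fromℕ< (ℕ.s≤s j≤J)) {β}))
      k j≤J)
    (eventually-× eventually-decreasing eventually-signs)
    where
    open IsSpectrum spectrum

    Agree : ℕ → Bool → ℕ → Set
    Agree m β j = Sign (path-charpoly (suc (suc n-2)) (sample j)) β →
                  Sign (product λ i → sample j ℚ.- seq (λs i) m) β

    eventually-decreasing : Eventually λ m →
      ∀ i i′ → toℕ i ℕ.≤ toℕ i′ → seq (λs i′) m ℚ.≤ seq (λs i) m ℚ.+ δ
    eventually-decreasing = eventually-∀ λ i → eventually-∀ λ i′ → pair i i′
      where
      pair : ∀ i i′ → Eventually λ m → toℕ i ℕ.≤ toℕ i′ → seq (λs i′) m ℚ.≤ seq (λs i) m ℚ.+ δ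
      pair i i′ with toℕ i ℕ.≤? toℕ i′
      ... | yes i≤i′ = eventually-map (λ le _ → le) (decreasing i≤i′ δ 0<δ)
      ... | no  i≰i′ = 0 , λ _ _ i≤i′ → ⊥-elim (i≰i′ i≤i′)

    eventually-signs : Eventually λ m → ∀ (j : Fin (suc J)) {β} → Agree m β (toℕ j)
    eventually-signs = eventually-∀ λ j → eventually-map
      (λ {m} same {β} sgn → subst (λ p → Sign p β)
        (seq-∏ (λ i → fromℚ (sample (toℕ j)) - λs i) m) (same sgn))
      (eventually-sign {charpoly (laplacian (path (suc (suc n-2)))) (fromℚ (sample (toℕ j)))}
        {∏ λ i → fromℚ (sample (toℕ j)) - λs i} {path-charpoly (suc (suc n-2)) (sample (toℕ j))}
        (seq-path-charpoly n-2 (sample (toℕ j))) (factors (fromℚ (sample (toℕ j)))))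

-- Choice of the threshold and conclusion.

proposition3p7 : ∀ (k₀ : ℕ) (ε : ℝ) → 1 ℕ.≤ k₀ → 0ℝ < ε →
    ∃[ n₀ ] Σ[ 2k₀≤n₀ ∈ 2 ℕ.* k₀ ℕ.≤ n₀ ]
    (∀ (n k : ℕ) (n₀≤n : n₀ ℕ.≤ n) → 1 ℕ.≤ k → (k≤k₀ : k ℕ.≤ k₀) →
     ∀ (λs : Vector ℝ n) → IsSpectrum (laplacian (path n)) λs →
     let 2k≤n = ≤-trans (*-monoʳ-≤ 2 k≤k₀) (≤-trans 2k₀≤n₀ n₀≤n)
         k≤n  = ≤-trans (m≤n*m k 2) 2k≤n
     in ∑[ 2k≤n ] (fromℕ ∘ d (path n)) - ∑[ k≤n ] λs < ε)
proposition3p7 k₀ ε 1≤k₀ (η , 0<η , eventually-η) = n₀ , 2k₀≤n₀ , bound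
  where
  J W n₀ : ℕ
  -- `J` is the last sample ever used, and `W`, four times `J`, is the multiple of `b` by which it
  -- may fall below 4 in `4≤sample`.
  J = suc (k₀ ℕ.+ k₀)
  W = J ℕ.+ J ℕ.+ (J ℕ.+ J)

  δ-exists : ∃[ δ ] 0ℚ ℚ.< δ × J · δ ≡ η
  δ-exists = ·-÷ (k₀ ℕ.+ k₀) 0<η
  δ = proj₁ δ-exists
  0<δ = proj₁ (proj₂ δ-exists)
  0≤δ = ℚ.<⇒≤ 0<δ

  M-exists : ∃[ M ] 1ℚ ℚ.≤ suc M · δ
  M-exists = archimedean 0<δ
  M = proj₁ M-exists
  -- For n ≥ n₀ this gives `suc M · (W · b) ≤ n · b = ½ ≤ suc M · δ`, hence `W · b ≤ δ`.
  n₀ = suc M ℕ.* W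

  W≤n₀ : W ℕ.≤ n₀
  W≤n₀ = ℕ.m≤m+n W (M ℕ.* W)

  2J≤n₀ : J ℕ.+ J ℕ.≤ n₀
  2J≤n₀ = ℕ.≤-trans (ℕ.m≤m+n (J ℕ.+ J) (J ℕ.+ J)) W≤n₀

  2k₀≤n₀ : 2 ℕ.* k₀ ℕ.≤ n₀
  2k₀≤n₀ = ℕ.≤-trans (ℕ.≤-trans (ℕ.≤-reflexive (cong (k₀ ℕ.+_) (ℕ.+-identityʳ k₀)))
    (ℕ.≤-trans (ℕ.n≤1+n _) (ℕ.m≤m+n J J))) 2J≤n₀

  bound : ∀ n k (n₀≤n : n₀ ℕ.≤ n) → 1 ℕ.≤ k → (k≤k₀ : k ℕ.≤ k₀) →
    ∀ (λs : Vector ℝ n) → IsSpectrum (laplacian (path n)) λs →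
    let 2k≤n = ≤-trans (*-monoʳ-≤ 2 k≤k₀) (≤-trans 2k₀≤n₀ n₀≤n)
        k≤n  = ≤-trans (m≤n*m k 2) 2k≤n
    in ∑[ 2k≤n ] (fromℕ ∘ d (path n)) - ∑[ k≤n ] λs < ε
  bound zero    k n₀≤n = ⊥-elim (ℕ.<⇒≱ (ℕ.s≤s ℕ.z≤n) (ℕ.≤-trans 2J≤n₀ n₀≤n))
  bound (suc zero) k n₀≤n = ⊥-elim (ℕ.<⇒≱ (ℕ.s≤s (ℕ.s≤s ℕ.z≤n))
    (ℕ.≤-trans (ℕ.+-mono-≤ (ℕ.s≤s ℕ.z≤n) (ℕ.s≤s ℕ.z≤n)) (ℕ.≤-trans 2J≤n₀ n₀≤n)))
  bound n@(suc (suc n-2)) k n₀≤n 1≤k k≤k₀ λs spectrum = δ , 0<δ , eventually-map final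
    (eventually-× eventually-η
      (eventually-≤-eigenvalue {n-2} {J} {δ} 0<δ (ℕ.≤-trans 2J≤n₀ n₀≤n) Wb≤δ spectrum k j≤J))
    where
    open Angle (suc n-2) using (b; nb≡½; 0≤b)

    j≤J : suc (k ℕ.+ k) ℕ.≤ J
    j≤J = ℕ.s≤s (ℕ.+-mono-≤ k≤k₀ k≤k₀)

    Wb≤δ : W · b ℚ.≤ δ
    Wb≤δ = ·-cancelˡ-≤ M (begin
      suc M · (W · b)    ≡⟨ ·-assocˡ b (suc M) W ⟩
      n₀ · b             ≤⟨ ·-monoˡ-≤ 0≤b n₀≤n ⟩
      n · b              ≡⟨ nb≡½ ⟩
      ½                  ≤⟨ ℚ.≤ᵇ⇒≤ _ ⟩
      1ℚ                 ≤⟨ proj₂ M-exists ⟩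
      suc M · δ          ∎)
      where open ℚ.≤-Reasoning

    2k≤n = ≤-trans (*-monoʳ-≤ 2 k≤k₀) (≤-trans 2k₀≤n₀ n₀≤n)
    k≤n  = ≤-trans (m≤n*m k 2) 2k≤n

    final : ∀ {m} →
      (0ℚ ℚ.+ η ℚ.≤ seq ε m) ×
      (∀ i → toℕ i ℕ.< k → ι 4 ℚ.- δ ℚ.- δ ℚ.≤ seq (λs i) m) →
      seq (∑[ 2k≤n ] (fromℕ ∘ d (path n)) - ∑[ k≤n ] λs) m ℚ.+ δ ℚ.≤ seq ε m
    final {m} (η≤ε , λ-large) = begin
      seq (∑[ 2k≤n ] (fromℕ ∘ d (path n)) - ∑[ k≤n ] λs) m ℚ.+ δ
        ≡⟨ cong₂ (λ y z → y ℚ.- z ℚ.+ δ)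
             (seq-∑ (λ i → fromℕ (d (path n) (Fin.inject≤ i 2k≤n))) m)
             (seq-∑ (λ i → λs (Fin.inject≤ i k≤n)) m) ⟩
      sum f ℚ.- sum g ℚ.+ δ
        ≤⟨ sum-bound k {δ} {f} {g} (λ i → ι-≤2 (d-≤2 (Fin.inject≤ i 2k≤n)))
             (λ i → λ-large (Fin.inject≤ i k≤n)
               (subst (ℕ._< k) (sym (Fin.toℕ-inject≤ i k≤n)) (Fin.toℕ<n i))) ⟩
      suc (k ℕ.+ k) · δ
        ≤⟨ ·-monoˡ-≤ 0≤δ j≤J ⟩
      J · δ
        ≡⟨ proj₂ (proj₂ δ-exists) ⟩
      η
        ≡⟨ ℚ.+-identityˡ η ⟨
      0ℚ ℚ.+ η
        ≤⟨ η≤ε ⟩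
      seq ε m ∎
      where
      open ℚ.≤-Reasoning
      f : Vector ℚ (2 ℕ.* k)
      f i = ι (d (path n) (Fin.inject≤ i 2k≤n))
      g : Vector ℚ k
      g i = seq (λs (Fin.inject≤ i k≤n)) m
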